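{- Let $\phi$ be a conjunction of xor-clauses in 3-xor normal form. If $\phi$ is cycle-partitionable, then $\phi$ is Subst-deducible (and thus also EC-deducible).
   Context: **Xor-clauses.** An xor-clause is an equation $z_1\oplus\dots\oplus z_k\equiv p$ over distinct propositional variables with $p\in\{\bot,\top\}$ ($\oplus$ is exclusive or); equivalently an expression $z_1\oplus\dots\oplus z_k$ (parity $\top$) or $z_1\oplus\dots\oplus z_k\oplus\top$ (parity $\bot$), always kept in normal form by cancelling repeated atoms. The literal $x$ is identified with $(x\equiv\top)$ and $\neg x$ with $(x\equiv\bot)$. The unsatisfiable empty xor-clause is identified with $\bot$. $\mathrm{vars}(\phi)$ is the set of variables of $\phi$, $\mathrm{lits}(\phi)=\{x,\neg x\mid x\in\mathrm{vars}(\phi)\}$, and $\models$ is logical consequence. **3-xor normal form.** $\phi$ is in 3-xor normal form if (i) every xor-clause in it has exactly three variables, and (ii) each pair of distinct xor-clauses in it shares at most one variable. **Xor-cycles and cycle-partitionability.** An xor-cycle in $\phi$ is a conjunction of pairwise distinct xor-clauses of $\phi$ of the form $(x_1\oplus x_2\oplus y_1\equiv p_1)\wedge\dots\wedge(x_{n-1}\oplus x_n\oplus y_{n-1}\equiv p_{n-1})\wedge(x_1\oplus x_n\oplus y_n\equiv p_n)$ with $n\ge 3$ and $x_1,\dots,x_n$ pairwise distinct; $X=\{x_1,\dots,x_n\}$ are its inner variables and $Y=\{y_1,\dots,y_n\}$ its outer variables. $\phi$ is cycle-partitionable if there is a partition of $\mathrm{vars}(\phi)$ into two disjoint sets $V_{\mathrm{in}},V_{\mathrm{out}}$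 such that for each xor-cycle in $\phi$, with inner variables $X$ and outer variables $Y$, $X\subseteq V_{\mathrm{in}}$ and $Y\subseteq V_{\mathrm{out}}$. **Subst.** $C[A/D]$ is the normal form of the xor-clause obtained from $C$ by replacing the atom $A$ by $D$ (all occurrences, once). The rules of Subst are, for variables $x,y$ and an xor-clause $C$: from $(x\equiv\top)$ and $C$ infer $C[x/\top]$; from $(x\equiv\bot)$ and $C$ infer $C[x/\bot]$; from $(x\oplus y\equiv\bot)$ and $C$ infer $C[x/y]$; from $(x\oplus y\equiv\top)$ and $C$ infer $C[x/(y\oplus\top)]$. **EC.** The rules of EC are (variables in one displayed xor-clause are distinct, $x_1,\dots,x_n$ pairwise distinct, $a,b,c_i,d\in\{\bot,\top\}$): from $(x\equiv\top),(x\equiv\bot)$ infer $\bot$; from $(x\equiv a),(x\oplus y\equiv b)$ infer $(y\equiv a\oplus b)$; from $(x\equiv a),(x\oplus y\oplus z\equiv b)$ infer $(y\oplus z\equiv a\oplus b)$; from $(x_1\oplus x_2\equiv c_1),\dots,(x_{n-1}\oplus x_n\equiv c_{n-1}),(x_1\oplus x_n\oplus y\equiv d)$ infer $(y\equiv c_1\oplus\dots\oplus c_{n-1}\oplus d)$; from $(x_1\oplus x_2\equiv c_1),\dots,(x_{n-1}\oplus x_n\equiv c_{n-1}),(x_n\oplus x_1\equiv c_n)$ with $c_1\oplus\dots\oplus c_n=\top$ infer $\bot$. **Derivability and deducibility.** For $S\in\{\mathrm{Subst},\mathrm{EC}\}$, an $S$-derivation from $\psi$ is a finite sequence of xor-clauses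 each in $\psi$ or inferred from earlier ones by a rule of $S$; $\psi\vdash_S D$ means $D$ occurs in some $S$-derivation from $\psi$. $\phi$ is $S$-deducible if for all $k\ge0$ and $\tilde l_1,\dots,\tilde l_k,\hat l\in\mathrm{lits}(\phi)$: (i) if $\phi\wedge\tilde l_1\wedge\dots\wedge\tilde l_k$ is unsatisfiable, then $\phi\wedge\tilde l_1\wedge\dots\wedge\tilde l_k\vdash_S\bot$; and (ii) otherwise, $\phi\wedge\tilde l_1\wedge\dots\wedge\tilde l_k\models\hat l$ implies $\phi\wedge\tilde l_1\wedge\dots\wedge\tilde l_k\vdash_S\hat l$. -}

module Defs where

open import Data.Bool.Base using (Bool; true; false; if_then_else_; _∧_; _xor_)
open import Data.Fin.Base using (Fin; zero; suc; inject₁; fromℕ)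
open import Data.Fin.Subset as Subset using (Subset; ⁅_⁆; _∩_; _∪_; ⋃; ∣_∣)
open import Data.List.Base using (List; []; _∷_; _++_; [_]; map; foldr; tabulate)
open import Data.List.Membership.Propositional using (_∈_)
open import Data.List.Relation.Unary.All using (All)
open import Data.List.Relation.Unary.Unique.Propositional using (Unique)
open import Data.Nat.Base using (ℕ; suc; _≤_)
open import Data.Product.Base using (_×_; _,_; proj₁; ∃-syntax)
open import Data.Sum.Base using (_⊎_)
open import Data.Vec.Base using (lookup; zipWith)
open import Function.Definitions using (Injective)
open import Relation.Binary.PropositionalEquality using (_≡_; _≢_)
open import Relation.Nullary.Negation using (¬_)

private
  variable
    n : ℕ

-- The propositional variables are the elements of Fin n, with n arbitrary.

-- An xor-clause in normal form: the xor of the variables in `vars` equals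
-- `parity`.  Two xor-clauses are the same iff they are propositionally equal.
record XorClause (n : ℕ) : Set where
  constructor _≐_
  field
    vars   : Subset n
    parity : Bool

open XorClause public

infix 4 _≐_
infixr 6 _△_

_△_ : Subset n → Subset n → Subset n
_△_ = zipWith _xor_

-- Repeated variables cancel.
⨁ : List (Fin n) → Subset n
⨁ = foldr (λ z S → ⁅ z ⁆ △ S) Subset.⊥

unit : Fin n → Bool → XorClause n
unit x p = ⨁ (x ∷ []) ≐ p

binary : Fin n → Fin n → Bool → XorClause n
binary x y p = ⨁ (x ∷ y ∷ []) ≐ p

ternary : Fin n → Fin n → Fin n → Bool → XorClause n
ternary x y z p = ⨁ (x ∷ y ∷ z ∷ []) ≐ p

-- The unsatisfiable empty xor-clause: the empty xor (false) equals true.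
⊥-clause : XorClause n
⊥-clause = Subset.⊥ ≐ true

Formula : ℕ → Set
Formula n = List (XorClause n)

varsOf : Formula n → Subset n
varsOf φ = ⋃ (map vars φ)

xorSum : ∀ {k} → (Fin k → Bool) → Bool
xorSum b = foldr _xor_ false (tabulate b)

Assignment : ℕ → Set
Assignment n = Fin n → Bool

_⊩_ : Assignment n → XorClause n → Set
v ⊩ C = xorSum (λ i → lookup (vars C) i ∧ v i) ≡ parity C

_⊩*_ : Assignment n → Formula n → Set
v ⊩* φ = All (v ⊩_) φ

Satisfiable : Formula n → Set
Satisfiable φ = ∃[ v ] v ⊩* φ

Unsatisfiable : Formula n → Set
Unsatisfiable φ = ¬ Satisfiable φ

_⊨_ : Formula n → XorClause n → Set
φ ⊨ C = ∀ v → v ⊩* φ → v ⊩ C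

-- (x , true) is the literal x and (x , false) is the literal ¬x.
Literal : ℕ → Set
Literal n = Fin n × Bool

_∈lits_ : Literal n → Formula n → Set
l ∈lits φ = proj₁ l Subset.∈ varsOf φ

litClause : Literal n → XorClause n
litClause (x , b) = unit x b

record Is3XorNF (φ : Formula n) : Set where
  field
    threeVars     : ∀ {C} → C ∈ φ → ∣ vars C ∣ ≡ 3
    shareAtMost1  : ∀ {C D} → C ∈ φ → D ∈ φ → C ≢ D → ∣ vars C ∩ vars D ∣ ≤ 1

-- The cycle has length suc k.  With indices shifted to start at 0, its
-- xor-clauses are  x i ⊕ x (i+1) ⊕ y i ≡ p i  for i < k, and
-- x 0 ⊕ x k ⊕ y k ≡ p k.
record XorCycle (φ : Formula n) : Set where
  field
    k              : ℕ
    length≥3       : 3 ≤ suc k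
    x y            : Fin (suc k) → Fin n
    p              : Fin (suc k) → Bool
    clause         : Fin (suc k) → XorClause n
    clause∈φ       : ∀ i → clause i ∈ φ
    clauseDistinct : Injective _≡_ _≡_ clause
    xDistinct      : Injective _≡_ _≡_ x
    step           : ∀ (i : Fin k) →
                     clause (inject₁ i) ≡ ternary (x (inject₁ i)) (x (suc i)) (y (inject₁ i)) (p (inject₁ i))
    stepUnique     : ∀ (i : Fin k) →
                     Unique (x (inject₁ i) ∷ x (suc i) ∷ y (inject₁ i) ∷ [])
    close          : clause (fromℕ k) ≡ ternary (x zero) (x (fromℕ k)) (y (fromℕ k)) (p (fromℕ k))
    closeUnique    : Unique (x zero ∷ x (fromℕ k) ∷ y (fromℕ k) ∷ [])

record CyclePartitionable (φ : Formula n) : Set where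
  field
    Vin Vout : Subset n
    covers   : Vin ∪ Vout ≡ varsOf φ
    disjoint : Vin ∩ Vout ≡ Subset.⊥
    inner    : ∀ (c : XorCycle φ) i → XorCycle.x c i Subset.∈ Vin
    outer    : ∀ (c : XorCycle φ) i → XorCycle.y c i Subset.∈ Vout

-- R Ps C: the rule system R infers C from the premises Ps.
Rules : ℕ → Set₁
Rules n = List (XorClause n) → XorClause n → Set

-- The most recently derived xor-clause comes first.
data IsDerivation (R : Rules n) (ψ : Formula n) : List (XorClause n) → Set where
  []  : IsDerivation R ψ []
  _∷_ : ∀ {C Cs} →
        C ∈ ψ ⊎ (∃[ Ps ] All (_∈ Cs) Ps × R Ps C) →
        IsDerivation R ψ Cs →
        IsDerivation R ψ (C ∷ Cs)

_⊢[_]_ : Formula n → Rules n → XorClause n → Set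
ψ ⊢[ R ] D = ∃[ Cs ] IsDerivation R ψ Cs × D ∈ Cs

record Deducible (R : Rules n) (φ : Formula n) : Set where
  field
    refutes : ∀ (ls : List (Literal n)) → All (_∈lits φ) ls →
              Unsatisfiable (φ ++ map litClause ls) →
              (φ ++ map litClause ls) ⊢[ R ] ⊥-clause
    implies : ∀ (ls : List (Literal n)) → All (_∈lits φ) ls →
              ∀ (l : Literal n) → l ∈lits φ →
              Satisfiable (φ ++ map litClause ls) →
              (φ ++ map litClause ls) ⊨ litClause l →
              (φ ++ map litClause ls) ⊢[ R ] litClause l

-- (T , q) is the expression  ⨁ T ⊕ q.
XorExpr : ℕ → Set
XorExpr n = Subset n × Bool

-- Replacing x by ⨁ T ⊕ q in  x ⊕ ⨁ S ≡ p  gives  ⨁ S ⊕ ⨁ T ≡ p ⊕ q.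
_[_/_] : XorClause n → Fin n → XorExpr n → XorClause n
C [ x / (T , q) ] =
  if lookup (vars C) x
  then (vars C Subset.- x) △ T ≐ parity C xor q
  else C

constₑ : Bool → XorExpr n
constₑ b = Subset.⊥ , b

varₑ : Fin n → XorExpr n
varₑ y = ⁅ y ⁆ , false

var⊕⊤ₑ : Fin n → XorExpr n
var⊕⊤ₑ y = ⁅ y ⁆ , true

data Subst {n : ℕ} : Rules n where
  unit⊤   : ∀ {x C} →
            Subst (unit x true ∷ C ∷ []) (C [ x / constₑ true ])
  unit⊥   : ∀ {x C} →
            Subst (unit x false ∷ C ∷ []) (C [ x / constₑ false ])
  binary⊥ : ∀ {x y C} → x ≢ y →
            Subst (binary x y false ∷ C ∷ []) (C [ x / varₑ y ])
  binary⊤ : ∀ {x y C} → x ≢ y →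
            Subst (binary x y true ∷ C ∷ []) (C [ x / var⊕⊤ₑ y ])

-- The xor-clauses  x 0 ⊕ x 1 ≡ c 0, …, x (k-1) ⊕ x k ≡ c (k-1).
path : ∀ {k} → (Fin (suc k) → Fin n) → (Fin k → Bool) → List (XorClause n)
path x c = tabulate (λ i → binary (x (inject₁ i)) (x (suc i)) (c i))

-- In the last two rules x₁, …, xₙ is  x 0, …, x k; the uniqueness premise
-- forces k ≥ 1, i.e. at least two variables.
data EC {n : ℕ} : Rules n where
  conflict      : ∀ {x} →
                  EC (unit x true ∷ unit x false ∷ []) ⊥-clause
  unitBinary    : ∀ {x y a b} → Unique (x ∷ y ∷ []) →
                  EC (unit x a ∷ binary x y b ∷ []) (unit y (a xor b))
  unitTernary   : ∀ {x y z a b} → Unique (x ∷ y ∷ z ∷ []) →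
                  EC (unit x a ∷ ternary x y z b ∷ []) (binary y z (a xor b))
  pathTernary   : ∀ {k} {x : Fin (suc k) → Fin n} {y} {c : Fin k → Bool} {d} →
                  Injective _≡_ _≡_ x →
                  Unique (x zero ∷ x (fromℕ k) ∷ y ∷ []) →
                  EC (path x c ++ [ ternary (x zero) (x (fromℕ k)) y d ])
                     (unit y (xorSum c xor d))
  cycleConflict : ∀ {k} {x : Fin (suc k) → Fin n} {c : Fin k → Bool} {d} →
                  Injective _≡_ _≡_ x →
                  Unique (x (fromℕ k) ∷ x zero ∷ []) →
                  xorSum c xor d ≡ true →
                  EC (path x c ++ [ binary (x (fromℕ k)) (x zero) d ]) ⊥-clause

{-# OPTIONS --safe #-}

-- Over 𝔽₂, an unsatisfiable φ ∧ l₁ ∧ … ∧ lₖ has a subset F of the clauses of φ whose sum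
-- mentions only assigned variables and is violated by the assignment.  By induction on F,
-- unit propagation on the sum of F is simulated by the rules of EC:
--   * If F is the union of two parts sharing at most one variable v, propagate the value of v
--     from one part to the other.
--   * Otherwise every variable v shared by two clauses C, D of F is an inner variable of a
--     cycle: grow the set of clauses reachable from D without using C or v; if it never meets
--     another variable of C, it is separated from the rest of F by v alone.  Hence, by
--     cycle-partitionability, the outer variables of a cycle occur only once in F, so they
--     remain in the sum, while the inner variables of the cycle cancel.  The sum of F then splits
--     into the sum of the cycle, which is propagated by the path rule, and the sum of the rest.
-- Subst simulates EC, since the path rule is iterated substitution of equivalent variables.

module Submission where

open import Defs
open import Algebra.Bundles using (CommutativeMonoid)
open import Algebra.Structures using (IsCommutativeMonoid)
open import Data.Bool.Base using (Bool; true; false; not; _∧_; _xor_)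
open import Data.Bool.Properties as Bool using (xor-same; xor-comm; xor-assoc; xor-identityʳ)
open import Data.Bool.Solver using (module xor-∧-Solver)
open import Data.Fin.Base using (Fin; zero; suc; inject₁; fromℕ)
import Data.Fin.Properties as Fin
open import Data.Fin.Relation.Unary.Top using (view; ‵fromℕ; ‵inject₁)
open import Data.Fin.Subset as Subset using (Subset; ⁅_⁆; _∩_; ∣_∣)
open import Data.List.Base using (List; []; _∷_; _++_; [_]; map; foldr; tabulate; length; deduplicate)
import Data.List.Membership.DecPropositional as DecMembership
open import Data.List.Membership.Propositional using (_∈_; find; lose)
import Data.List.Membership.Propositional.Properties as Mem
import Data.List.Properties as List
open import Data.List.Relation.Binary.Permutation.Propositional using (_↭_; ↭-refl; ↭-sym; ↭-trans; ↭-prep; ↭⇒↭ₛ)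
open import Data.List.Relation.Binary.Permutation.Propositional.Properties using (∈-resp-↭; ↭-length; shift; ++⁺ˡ)
import Data.List.Relation.Binary.Permutation.Setoid.Properties as Permutationₛ
open import Data.List.Relation.Binary.Sublist.Propositional using (_⊆_; []; _∷_; _∷ʳ_; ⊆-refl) renaming (lookup to ⊆-lookup)
import Data.List.Relation.Binary.Sublist.Propositional.Properties as Sublist
open import Data.List.Relation.Unary.All as All using (All; []; _∷_)
import Data.List.Relation.Unary.All.Properties as All
open import Data.List.Relation.Unary.AllPairs using ([]; _∷_)
open import Data.List.Relation.Unary.Any as Any using (here; there)
open import Data.List.Relation.Unary.Unique.DecPropositional.Properties using (deduplicate-!)
open import Data.List.Relation.Unary.Unique.Propositional using (Unique)
import Data.List.Relation.Unary.Unique.Propositional.Properties as Unique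
open import Data.Nat.Base using (ℕ; zero; suc; _+_; _≤_; _<_; z≤n; s≤s)
import Data.Nat.Properties as ℕ
open import Data.Product.Base using (_×_; _,_; proj₁; proj₂; ∃-syntax; Σ-syntax)
open import Data.Product.Properties using () renaming (≡-dec to ×-≡-dec)
open import Data.Sum.Base using (_⊎_; inj₁; inj₂; [_,_]′)
open import Data.Vec.Base using (Vec; lookup; []; _∷_)
import Data.Vec.Properties as Vec
open import Function.Base using (_∘_)
open import Function.Bundles using (module Equivalence)
open import Function.Definitions using (Injective)
open import Relation.Binary.Definitions using (DecidableEquality)
open import Relation.Binary.PropositionalEquality hiding ([_])
open import Relation.Nullary using (¬_; Dec; yes; no; does; contradiction)
open import Relation.Nullary.Decidable using (_×-dec_; ¬?; decidable-stable; map′; dec-true)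

open Equivalence using (to; from)

private
  variable
    n k m : ℕ
    X : Set

-- Symmetric difference

△-assoc : (S T U : Subset n) → (S △ T) △ U ≡ S △ (T △ U)
△-assoc = Vec.zipWith-assoc xor-assoc

△-comm : (S T : Subset n) → S △ T ≡ T △ S
△-comm = Vec.zipWith-comm xor-comm

△-identityˡ : (S : Subset n) → Subset.⊥ △ S ≡ S
△-identityˡ = Vec.zipWith-identityˡ Bool.xor-identityˡ

△-identityʳ : (S : Subset n) → S △ Subset.⊥ ≡ S
△-identityʳ = Vec.zipWith-identityʳ xor-identityʳ

△-self : (S : Subset n) → S △ S ≡ Subset.⊥
△-self []      = refl
△-self (s ∷ S) = cong₂ _∷_ (xor-same s) (△-self S)

△-isCommutativeMonoid : IsCommutativeMonoid _≡_ (_△_ {n}) Subset.⊥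
△-isCommutativeMonoid = record
  { isMonoid = record
    { isSemigroup = record
      { isMagma = record { isEquivalence = isEquivalence ; ∙-cong = cong₂ _△_ }
      ; assoc   = △-assoc
      }
    ; identity = △-identityˡ , △-identityʳ
    }
  ; comm = △-comm
  }

△-commutativeMonoid : ℕ → CommutativeMonoid _ _
△-commutativeMonoid n = record { isCommutativeMonoid = △-isCommutativeMonoid {n} }

module △ {n : ℕ} where
  open CommutativeMonoid (△-commutativeMonoid n) public using (commutativeSemigroup)
  open import Algebra.Properties.CommutativeSemigroup commutativeSemigroup public
    using (interchange; x∙yz≈y∙xz)

△-cancel : (S T U : Subset n) → (S △ T) △ (S △ U) ≡ T △ U
△-cancel S T U = begin
  (S △ T) △ (S △ U) ≡⟨ △.interchange S T S U ⟩
  (S △ S) △ (T △ U) ≡⟨ cong (_△ (T △ U)) (△-self S) ⟩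
  Subset.⊥ △ (T △ U) ≡⟨ △-identityˡ _ ⟩
  T △ U             ∎
  where open ≡-Reasoning

lookup-△ : ∀ (S T : Subset n) u → lookup (S △ T) u ≡ lookup S u xor lookup T u
lookup-△ S T u = Vec.lookup-zipWith _xor_ u S T

lookup-⊥ : (u : Fin n) → lookup Subset.⊥ u ≡ false
lookup-⊥ u = Vec.lookup-replicate u false

lookup-⁅⁆ : (u : Fin n) → lookup ⁅ u ⁆ u ≡ true
lookup-⁅⁆ zero    = refl
lookup-⁅⁆ (suc u) = lookup-⁅⁆ u

lookup-⁅⁆⁻ : ∀ (u v : Fin n) → lookup ⁅ v ⁆ u ≡ true → u ≡ v
lookup-⁅⁆⁻ zero    zero    _  = refl
lookup-⁅⁆⁻ (suc u) zero    eq = contradiction (trans (sym (lookup-⊥ u)) eq) λ ()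
lookup-⁅⁆⁻ (suc u) (suc v) eq = cong suc (lookup-⁅⁆⁻ u v eq)

lookup-⁅⁆-≢ : ∀ {u v : Fin n} → u ≢ v → lookup ⁅ v ⁆ u ≡ false
lookup-⁅⁆-≢ {u = u} {v} u≢v = Bool.¬-not (u≢v ∘ lookup-⁅⁆⁻ u v)

-≡△ : ∀ (S : Subset n) x → lookup S x ≡ true → S Subset.- x ≡ S △ ⁅ x ⁆
-≡△ (true ∷ S) zero refl = cong (false ∷_) (trans (─-⊥ S) (sym (△-identityʳ S)))
  where
  ─-⊥ : ∀ {n} (S : Subset n) → S Subset.─ Subset.⊥ ≡ S
  ─-⊥ []      = refl
  ─-⊥ (s ∷ S) = cong (s ∷_) (─-⊥ S)
-≡△ (s ∷ S) (suc x) eq = cong₂ _∷_ (sym (xor-identityʳ s)) (-≡△ S x eq)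

∣S∣≡0⇒S≡⊥ : (S : Subset n) → ∣ S ∣ ≡ 0 → S ≡ Subset.⊥
∣S∣≡0⇒S≡⊥ []          _  = refl
∣S∣≡0⇒S≡⊥ (false ∷ S) eq = cong (false ∷_) (∣S∣≡0⇒S≡⊥ S eq)

∣S∣>0⇒inhabited : (S : Subset n) → 0 < ∣ S ∣ → ∃[ x ] lookup S x ≡ true
∣S∣>0⇒inhabited (true ∷ S)  _ = zero , refl
∣S∣>0⇒inhabited (false ∷ S) p with x , eq ← ∣S∣>0⇒inhabited S p = suc x , eq

split-element : ∀ (S : Subset n) x → lookup S x ≡ true →
                ∃[ T ] S ≡ ⁅ x ⁆ △ T × ∣ S ∣ ≡ suc ∣ T ∣ × lookup T x ≡ false
split-element (true ∷ S) zero refl =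
  false ∷ S , cong (true ∷_) (sym (△-identityˡ S)) , refl , refl
split-element (s ∷ S) (suc x) eq with T , S≡ , size , T∌x ← split-element S x eq =
  s ∷ T , cong (s ∷_) S≡ , count s size , T∌x
  where
  count : ∀ s → ∣ S ∣ ≡ suc ∣ T ∣ → ∣ s ∷ S ∣ ≡ suc ∣ s ∷ T ∣
  count true  = cong suc
  count false eq = eq

split-element-≢ : ∀ {S T : Subset n} {x} → S ≡ ⁅ x ⁆ △ T → ∀ {y} → x ≢ y →
                  lookup S y ≡ true → lookup T y ≡ true
split-element-≢ {T = T} {x} refl {y} x≢y eq =
  trans (sym (trans (lookup-△ ⁅ x ⁆ T y) (cong (_xor lookup T y) (lookup-⁅⁆-≢ (x≢y ∘ sym))))) eq

-- Peeling off `x` and `y` leaves exactly one element. It supplies the outer variable of a clause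
-- whose two inner variables are known.
third-element : ∀ (S : Subset n) {x y} → ∣ S ∣ ≡ 3 → x ≢ y →
                lookup S x ≡ true → lookup S y ≡ true →
                ∃[ z ] S ≡ ⨁ (x ∷ y ∷ z ∷ []) × Unique (x ∷ y ∷ z ∷ [])
third-element S {x} {y} size x≢y Sx Sy
  with T , S≡ , ∣T∣ , T∌x ← split-element S x Sx
  with U , T≡ , ∣U∣ , U∌y ← split-element T y (split-element-≢ S≡ x≢y Sy)
  with z , Uz ← ∣S∣>0⇒inhabited U
                 (subst (0 <_) (ℕ.suc-injective (ℕ.suc-injective
                   (trans (sym size) (trans ∣T∣ (cong suc ∣U∣))))) (s≤s z≤n))
  with V , U≡ , ∣V∣ , _ ← split-element U z Uz
  = z
  , trans S≡ (cong (⁅ x ⁆ △_) (trans T≡ (cong (⁅ y ⁆ △_) (trans U≡ (cong (⁅ z ⁆ △_) V≡⊥)))))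
  , (x≢y ∷ x≢z ∷ []) ∷ (y≢z ∷ []) ∷ [] ∷ []
  where
  V≡⊥ : V ≡ Subset.⊥
  V≡⊥ = ∣S∣≡0⇒S≡⊥ V (ℕ.suc-injective (ℕ.suc-injective (ℕ.suc-injective
    (trans (sym (trans ∣T∣ (cong suc (trans ∣U∣ (cong suc ∣V∣))))) size))))
  y≢z : y ≢ z
  y≢z refl = contradiction (trans (sym Uz) U∌y) λ ()
  x≢z : x ≢ z
  x≢z refl = contradiction (trans (sym Tz) T∌x) λ ()
    where
    Tz : lookup T z ≡ true
    Tz = trans (cong (λ W → lookup W z) T≡)
           (trans (lookup-△ ⁅ y ⁆ U z) (cong₂ _xor_ (lookup-⁅⁆-≢ (y≢z ∘ sym)) Uz))

∣S∣≤1⇒≡ : ∀ (S : Subset n) {x y} → ∣ S ∣ ≤ 1 → lookup S x ≡ true → lookup S y ≡ true → x ≡ y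
∣S∣≤1⇒≡ S {x} {y} size Sx Sy with x Fin.≟ y
... | yes x≡y = x≡y
... | no  x≢y
  with T , S≡ , ∣T∣ , _ ← split-element S x Sx
  with U , _  , ∣U∣ , _ ← split-element T y (split-element-≢ S≡ x≢y Sy)
  = contradiction (subst (_≤ 1) (trans ∣T∣ (cong suc ∣U∣)) size) λ { (s≤s ()) }

lookup-⨁⁻ : ∀ (xs : List (Fin n)) {u} → lookup (⨁ xs) u ≡ true → u ∈ xs
lookup-⨁⁻ []       {u} eq = contradiction (trans (sym (lookup-⊥ u)) eq) λ ()
lookup-⨁⁻ (x ∷ xs) {u} eq with u Fin.≟ x
... | yes u≡x = here u≡x
... | no  u≢x = there (lookup-⨁⁻ xs (split-element-≢ refl (u≢x ∘ sym) eq))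

lookup-⨁ : ∀ {xs : List (Fin n)} {u} → Unique xs → u ∈ xs → lookup (⨁ xs) u ≡ true
lookup-⨁ {xs = x ∷ xs} {u} (x∉xs ∷ uniq) (here refl) =
  trans (lookup-△ ⁅ x ⁆ (⨁ xs) x) (cong₂ _xor_ (lookup-⁅⁆ x)
    (Bool.¬-not λ eq → All.lookup x∉xs (lookup-⨁⁻ xs eq) refl))
lookup-⨁ {xs = x ∷ xs} {u} (x∉xs ∷ uniq) (there u∈xs) =
  trans (lookup-△ ⁅ x ⁆ (⨁ xs) u)
    (cong₂ _xor_ (lookup-⁅⁆-≢ (≢-sym (All.lookup x∉xs u∈xs))) (lookup-⨁ uniq u∈xs))

-- Sums over 𝔽₂

xorSum-cong : {f g : Fin k → Bool} → f ≗ g → xorSum f ≡ xorSum g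
xorSum-cong {zero}  f≗g = refl
xorSum-cong {suc k} f≗g = cong₂ _xor_ (f≗g zero) (xorSum-cong (f≗g ∘ suc))

-- Abstract, because `with` would otherwise normalise the proofs of the solver.
abstract
  xor-interchange : ∀ a b c d → (a xor b) xor (c xor d) ≡ (a xor c) xor (b xor d)
  xor-interchange = solve 4 (λ a b c d → (a :+ b) :+ (c :+ d) := (a :+ c) :+ (b :+ d)) refl
    where open xor-∧-Solver

  xor-swapʳ : ∀ a b c → (a xor b) xor c ≡ (a xor c) xor b
  xor-swapʳ = solve 3 (λ a b c → (a :+ b) :+ c := (a :+ c) :+ b) refl
    where open xor-∧-Solver

  ternary-xor : ∀ a b c p → b xor (c xor p) ≡ a xor ((a xor (b xor (c xor false))) xor p)
  ternary-xor = solve 4 (λ a b c p → b :+ (c :+ p) := a :+ ((a :+ (b :+ (c :+ con false))) :+ p)) refl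
    where open xor-∧-Solver

  cycle-xor : ∀ a p aₘ pₘ → (a xor p) xor pₘ ≡ aₘ xor ((a xor aₘ) xor (p xor pₘ))
  cycle-xor = solve 4 (λ a p aₘ pₘ → (a :+ p) :+ pₘ := aₘ :+ ((a :+ aₘ) :+ (p :+ pₘ))) refl
    where open xor-∧-Solver

xorSum-xor : (f g : Fin k → Bool) → xorSum (λ i → f i xor g i) ≡ xorSum f xor xorSum g
xorSum-xor {zero}  f g = refl
xorSum-xor {suc k} f g =
  trans (cong ((f zero xor g zero) xor_) (xorSum-xor (f ∘ suc) (g ∘ suc)))
        (xor-interchange (f zero) (g zero) _ _)

xorSum-false : ∀ k → xorSum {k} (λ _ → false) ≡ false
xorSum-false zero    = refl
xorSum-false (suc k) = xorSum-false k

xorSum-last : (f : Fin (suc k) → Bool) → xorSum f ≡ xorSum (f ∘ inject₁) xor f (fromℕ k)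
xorSum-last {zero}  f = xor-identityʳ (f zero)
xorSum-last {suc k} f = trans (cong (f zero xor_) (xorSum-last (f ∘ suc)))
                              (sym (xor-assoc (f zero) _ _))

value : Assignment n → Subset n → Bool
value a S = xorSum (λ i → lookup S i ∧ a i)

value-△ : ∀ a (S T : Subset n) → value a (S △ T) ≡ value a S xor value a T
value-△ a S T = trans
  (xorSum-cong λ i → trans (cong (_∧ a i) (lookup-△ S T i))
                           (Bool.∧-distribʳ-xor (a i) (lookup S i) (lookup T i)))
  (xorSum-xor (λ i → lookup S i ∧ a i) (λ i → lookup T i ∧ a i))

value-xor : ∀ (a b : Assignment n) S → value (λ i → a i xor b i) S ≡ value a S xor value b S
value-xor a b S = trans
  (xorSum-cong λ i → Bool.∧-distribˡ-xor (lookup S i) (a i) (b i))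
  (xorSum-xor (λ i → lookup S i ∧ a i) (λ i → lookup S i ∧ b i))

value-⊥ : (a : Assignment n) → value a Subset.⊥ ≡ false
value-⊥ {n} a = trans (xorSum-cong λ i → cong (_∧ a i) (lookup-⊥ i)) (xorSum-false n)

value-⁅⁆ : ∀ a (u : Fin n) → value a ⁅ u ⁆ ≡ a u
value-⁅⁆ a zero    = trans (cong (a zero xor_) (value-⊥ (a ∘ suc))) (xor-identityʳ (a zero))
value-⁅⁆ a (suc u) = value-⁅⁆ (a ∘ suc) u

-- The pairing of assignments with sets is symmetric, so the singleton can be moved to the side of
-- the set.
value-indicator : ∀ v (S : Subset n) → value (lookup ⁅ v ⁆) S ≡ lookup S v
value-indicator v S = trans
  (xorSum-cong λ i → Bool.∧-comm (lookup S i) (lookup ⁅ v ⁆ i))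
  (value-⁅⁆ (lookup S) v)

value-⨁ : ∀ a (xs : List (Fin n)) → value a (⨁ xs) ≡ foldr _xor_ false (map a xs)
value-⨁ a []       = value-⊥ a
value-⨁ a (x ∷ xs) = trans (value-△ a ⁅ x ⁆ (⨁ xs)) (cong₂ _xor_ (value-⁅⁆ a x) (value-⨁ a xs))

-- Sums of xor-clauses

infixl 6 _⊕_

_⊕_ : XorClause n → XorClause n → XorClause n
C ⊕ D = vars C △ vars D ≐ parity C xor parity D

𝟘 : XorClause n
𝟘 = Subset.⊥ ≐ false

Σ⊕ : Formula n → XorClause n
Σ⊕ = foldr _⊕_ 𝟘

⊕-isCommutativeMonoid : IsCommutativeMonoid _≡_ (_⊕_ {n}) 𝟘
⊕-isCommutativeMonoid = record
  { isMonoid = record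
    { isSemigroup = record
      { isMagma = record { isEquivalence = isEquivalence ; ∙-cong = cong₂ _⊕_ }
      ; assoc   = λ C D E → cong₂ _≐_ (△-assoc (vars C) _ _) (xor-assoc (parity C) _ _)
      }
    ; identity = (λ C → cong₂ _≐_ (△-identityˡ (vars C)) refl)
               , (λ C → cong₂ _≐_ (△-identityʳ (vars C)) (xor-identityʳ (parity C)))
    }
  ; comm = λ C D → cong₂ _≐_ (△-comm (vars C) _) (xor-comm (parity C) _)
  }

⊕-commutativeMonoid : ℕ → CommutativeMonoid _ _
⊕-commutativeMonoid n = record { isCommutativeMonoid = ⊕-isCommutativeMonoid {n} }

module ⊕ {n : ℕ} where
  open CommutativeMonoid (⊕-commutativeMonoid n) public
    using (assoc; identityˡ; identityʳ)

Σ⊕-++ : (F G : Formula n) → Σ⊕ (F ++ G) ≡ Σ⊕ F ⊕ Σ⊕ G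
Σ⊕-++ []      G = sym (⊕.identityˡ _)
Σ⊕-++ (C ∷ F) G = trans (cong (C ⊕_) (Σ⊕-++ F G)) (sym (⊕.assoc C _ _))

_∈ᶜ_ : Fin n → XorClause n → Set
u ∈ᶜ C = lookup (vars C) u ≡ true

∈Σ⊕⁻ : ∀ (F : Formula n) {u} → u ∈ᶜ Σ⊕ F → ∃[ C ] C ∈ F × u ∈ᶜ C
∈Σ⊕⁻ []      {u} eq = contradiction (trans (sym (lookup-⊥ u)) eq) λ ()
∈Σ⊕⁻ (C ∷ F) {u} eq with lookup (vars C) u in Cu
... | true = C , here refl , Cu
... | false with D , D∈F , Du ← ∈Σ⊕⁻ F (trans (sym (trans (lookup-△ (vars C) _ u)
                                   (cong (_xor lookup (vars (Σ⊕ F)) u) Cu))) eq)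
  = D , there D∈F , Du

-- 1 when the assignment violates the clause.
defect : Assignment n → XorClause n → Bool
defect a C = value a (vars C) xor parity C

defect-⊕ : ∀ a (C D : XorClause n) → defect a (C ⊕ D) ≡ defect a C xor defect a D
defect-⊕ a C D = trans (cong (_xor (parity C xor parity D)) (value-△ a (vars C) (vars D)))
                       (xor-interchange (value a (vars C)) _ _ _)

xor≡false⇒≡ : ∀ a b → a xor b ≡ false → a ≡ b
xor≡false⇒≡ true  true  _ = refl
xor≡false⇒≡ false false _ = refl

⊩⇒defect : ∀ a (C : XorClause n) → a ⊩ C → defect a C ≡ false
⊩⇒defect a C eq = trans (cong (_xor parity C) eq) (xor-same (parity C))

defect⇒⊩ : ∀ a (C : XorClause n) → defect a C ≡ false → a ⊩ C
defect⇒⊩ a C = xor≡false⇒≡ (value a (vars C)) (parity C)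

flip : Fin n → Assignment n → Assignment n
flip v a u = a u xor lookup ⁅ v ⁆ u

flip-≡ : ∀ (v : Fin n) a → flip v a v ≡ not (a v)
flip-≡ v a rewrite lookup-⁅⁆ v = xor-comm (a v) true

flip-≢ : ∀ {u v : Fin n} a → u ≢ v → flip v a u ≡ a u
flip-≢ {u = u} a u≢v rewrite lookup-⁅⁆-≢ u≢v = xor-identityʳ (a u)

defect-flip : ∀ v a (C : XorClause n) → defect (flip v a) C ≡ defect a C xor lookup (vars C) v
defect-flip v a C = begin
  value (flip v a) S xor parity C                   ≡⟨ cong (_xor parity C) (value-xor a (lookup ⁅ v ⁆) S) ⟩
  (value a S xor value (lookup ⁅ v ⁆) S) xor parity C ≡⟨ cong (λ b → (value a S xor b) xor parity C) (value-indicator v S) ⟩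
  (value a S xor lookup S v) xor parity C           ≡⟨ xor-swapʳ (value a S) _ _ ⟩
  (value a S xor parity C) xor lookup S v           ∎
  where
  open ≡-Reasoning
  S = vars C

-- Linear algebra over 𝔽₂

-- Linear duality, by induction on `F`. If the functional `w` found for the tail does not vanish on
-- `C`, then `vars C △ T` is tried in place of `T`: if it is spanned, adding `C` spans `T`;
-- otherwise there is a second functional `w′`, and `w′` or `w + w′` separates.
separate-or-span : ∀ (F : Formula n) (T : Subset n) →
  (∃[ w ] All (λ C → value w (vars C) ≡ false) F × value w T ≡ true) ⊎
  (∃[ G ] G ⊆ F × vars (Σ⊕ G) ≡ T)
separate-or-span [] T with ∣ T ∣ in size
... | zero = inj₂ ([] , [] , sym (∣S∣≡0⇒S≡⊥ T size))
... | suc _ with u , Tu ← ∣S∣>0⇒inhabited T (subst (0 <_) (sym size) (s≤s z≤n)) =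
  inj₁ (lookup ⁅ u ⁆ , [] , trans (value-indicator u T) Tu)
separate-or-span (C ∷ F) T with separate-or-span F T
... | inj₂ (G , G⊆F , eq) = inj₂ (G , C ∷ʳ G⊆F , eq)
... | inj₁ (w , w⊥F , wT) with value w (vars C) in wC
...   | false = inj₁ (w , wC ∷ w⊥F , wT)
...   | true with separate-or-span F (vars C △ T)
...     | inj₂ (G , G⊆F , eq) = inj₂ (C ∷ G , refl ∷ G⊆F , (begin
  vars C △ vars (Σ⊕ G)      ≡⟨ cong (vars C △_) eq ⟩
  vars C △ (vars C △ T)     ≡⟨ △-assoc (vars C) (vars C) T ⟨
  (vars C △ vars C) △ T     ≡⟨ cong (_△ T) (△-self (vars C)) ⟩
  Subset.⊥ △ T              ≡⟨ △-identityˡ T ⟩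
  T                         ∎))
  where open ≡-Reasoning
...     | inj₁ (w′ , w′⊥F , w′CT) with value w′ (vars C) in w′C
...       | false = inj₁ (w′ , w′C ∷ w′⊥F ,
                     trans (sym (trans (value-△ w′ (vars C) T) (cong (_xor value w′ T) w′C))) w′CT)
-- Both functionals are 1 on `C`, so their sum vanishes there. On `T` the sum is 1 + 0, since `w′`
-- is 1 on both `C` and `vars C △ T`.
...       | true = inj₁ ((λ i → w i xor w′ i)
                     , trans (value-xor w w′ (vars C)) (cong₂ _xor_ wC w′C)
                       ∷ All.zipWith (λ {D} (p , q) → trans (value-xor w w′ (vars D)) (cong₂ _xor_ p q)) (w⊥F , w′⊥F)
                     , trans (value-xor w w′ T) (cong₂ _xor_ wT w′T))
  where
  w′T : value w′ T ≡ false
  w′T = Bool.not-injective (trans (sym (cong (_xor value w′ T) w′C))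
          (trans (sym (value-△ w′ (vars C) T)) w′CT))

defect-𝟘 : (a : Assignment n) → defect a 𝟘 ≡ false
defect-𝟘 a = trans (xor-identityʳ _) (value-⊥ a)

defect-Σ⊕ : ∀ {a} {F G : Formula n} → a ⊩* F → G ⊆ F → defect a (Σ⊕ G) ≡ false
defect-Σ⊕ {a = a} []      []  = defect-𝟘 a
defect-Σ⊕ (p ∷ ps) (D ∷ʳ G⊆F) = defect-Σ⊕ ps G⊆F
defect-Σ⊕ {a = a} (_∷_ {x = C} p ps) (_∷_ {xs = G} refl G⊆F) =
  trans (defect-⊕ a C (Σ⊕ G)) (cong₂ _xor_ (⊩⇒defect a C p) (defect-Σ⊕ ps G⊆F))

-- A model `v` of `F` violating `C` is corrected by a functional that vanishes on `F` but not on
-- `C`. If there is none, some clauses of `F` add up to the variables of `C`. Adding `C` leaves no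
-- variable, and the parity is 1 because `C` is the only summand that `v` violates.
satisfiable-or-refuted : (F : Formula n) → Satisfiable F ⊎ (∃[ G ] G ⊆ F × Σ⊕ G ≡ ⊥-clause)
satisfiable-or-refuted []      = inj₁ ((λ _ → false) , [])
satisfiable-or-refuted (C ∷ F) with satisfiable-or-refuted F
... | inj₂ (G , G⊆F , eq) = inj₂ (G , C ∷ʳ G⊆F , eq)
... | inj₁ (v , v⊩F) with defect v C in vC
...   | false = inj₁ (v , defect⇒⊩ v C vC ∷ v⊩F)
...   | true with separate-or-span F (vars C)
...     | inj₁ (w , w⊥F , wC) = inj₁ ((λ i → v i xor w i) , defect⇒⊩ _ C defect≡0 ∷
              All.zipWith (λ {D} (p , q) → trans (value-xor v w (vars D))
                (trans (cong₂ _xor_ p q) (xor-identityʳ _))) (v⊩F , w⊥F))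
  where
  defect≡0 : defect (λ i → v i xor w i) C ≡ false
  defect≡0 = begin
    value (λ i → v i xor w i) (vars C) xor parity C        ≡⟨ cong (_xor parity C) (value-xor v w (vars C)) ⟩
    (value v (vars C) xor value w (vars C)) xor parity C   ≡⟨ cong (λ b → (value v (vars C) xor b) xor parity C) wC ⟩
    (value v (vars C) xor true) xor parity C               ≡⟨ cong (_xor parity C) (xor-comm (value v (vars C)) true) ⟩
    not (value v (vars C)) xor parity C                    ≡⟨ Bool.not-distribˡ-xor (value v (vars C)) (parity C) ⟨
    not (defect v C)                                       ≡⟨ cong not vC ⟩
    false                                                  ∎
    where open ≡-Reasoning
...     | inj₂ (G , G⊆F , eq) = inj₂ (C ∷ G , refl ∷ G⊆F , cong₂ _≐_ vars≡⊥ parity≡true)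
  where
  vars≡⊥ : vars C △ vars (Σ⊕ G) ≡ Subset.⊥
  vars≡⊥ = trans (cong (vars C △_) eq) (△-self (vars C))
  parity≡true : parity (C ⊕ Σ⊕ G) ≡ true
  parity≡true = begin
    parity (C ⊕ Σ⊕ G)                       ≡⟨ cong (_xor parity (C ⊕ Σ⊕ G)) (value-⊥ v) ⟨
    value v Subset.⊥ xor parity (C ⊕ Σ⊕ G)  ≡⟨ cong (λ S → value v S xor parity (C ⊕ Σ⊕ G)) vars≡⊥ ⟨
    defect v (C ⊕ Σ⊕ G)                     ≡⟨ defect-⊕ v C (Σ⊕ G) ⟩
    defect v C xor defect v (Σ⊕ G)          ≡⟨ cong₂ _xor_ vC (defect-Σ⊕ v⊩F G⊆F) ⟩
    true                                    ∎
    where open ≡-Reasoning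

-- Closure under inference rules

Closed : Rules n → (XorClause n → Set) → Set
Closed R P = ∀ {Ps C} → All P Ps → R Ps C → P C

module _ {R : Rules n} {ψ : Formula n} where

  derivation-++ : ∀ {Cs Ds} → IsDerivation R ψ Cs → IsDerivation R ψ Ds → IsDerivation R ψ (Cs ++ Ds)
  derivation-++ []                             δ′ = δ′
  derivation-++ (inj₁ C∈ψ ∷ δ)                 δ′ = inj₁ C∈ψ ∷ derivation-++ δ δ′
  derivation-++ (inj₂ (Ps , Ps∈Cs , rule) ∷ δ) δ′ =
    inj₂ (Ps , All.map Mem.∈-++⁺ˡ Ps∈Cs , rule) ∷ derivation-++ δ δ′

  ⊢-premise : ∀ {C} → C ∈ ψ → ψ ⊢[ R ] C
  ⊢-premise C∈ψ = _ , inj₁ C∈ψ ∷ [] , here refl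

  ⊢-all : ∀ {Ps} → All (ψ ⊢[ R ]_) Ps → ∃[ Cs ] IsDerivation R ψ Cs × All (_∈ Cs) Ps
  ⊢-all [] = [] , [] , []
  ⊢-all ((Cs , δ , P∈Cs) ∷ ⊢Ps) with Ds , δ′ , Ps∈Ds ← ⊢-all ⊢Ps =
    Cs ++ Ds , derivation-++ δ δ′ , Mem.∈-++⁺ˡ P∈Cs ∷ All.map (Mem.∈-++⁺ʳ Cs) Ps∈Ds

  ⊢-closed : Closed R (ψ ⊢[ R ]_)
  ⊢-closed ⊢Ps rule with Cs , δ , Ps∈Cs ← ⊢-all ⊢Ps =
    _ , inj₂ (_ , Ps∈Cs , rule) ∷ δ , here refl

  -- With satisfaction by a model of `ψ` as `P`, this is soundness of derivations.
  ⊢-minimal : ∀ {P : XorClause n → Set} → Closed R P → All P ψ → ∀ {C} → ψ ⊢[ R ] C → P C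
  ⊢-minimal {P} closed Pψ (Cs , δ , C∈Cs) = All.lookup (go δ) C∈Cs
    where
    go : ∀ {Cs} → IsDerivation R ψ Cs → All P Cs
    go []                             = []
    go (inj₁ C∈ψ ∷ δ)                 = All.lookup Pψ C∈ψ ∷ go δ
    go (inj₂ (Ps , Ps∈Cs , rule) ∷ δ) = closed (All.map (All.lookup (go δ)) Ps∈Cs) rule ∷ go δ

-- Substitution as addition, and the simulation of EC by Subst

subst-⊕ : ∀ {C : XorClause n} {x T b} → x ∈ᶜ C → C [ x / (T , b) ] ≡ C ⊕ (⁅ x ⁆ △ T ≐ b)
subst-⊕ {C = C} {x} {T} x∈C rewrite x∈C =
  cong₂ _≐_ (trans (cong (_△ T) (-≡△ (vars C) x x∈C)) (△-assoc (vars C) ⁅ x ⁆ T)) refl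

subst-fresh : ∀ {C : XorClause n} {x e} → lookup (vars C) x ≡ false → C [ x / e ] ≡ C
subst-fresh x∉C rewrite x∉C = refl

-- Substituting for `x` in a clause containing `x` amounts to adding the other premise, as `x`
-- cancels; a clause without `x` is unchanged.
⊕-closed⇒Subst-closed : ∀ {P : XorClause n → Set} → (∀ {C D} → P C → P D → P (C ⊕ D)) → Closed Subst P
⊕-closed⇒Subst-closed {P = P} P-⊕ = go
  where
  step : ∀ C x T b → P C → P (⁅ x ⁆ △ T ≐ b) → P (C [ x / (T , b) ])
  step C x T b PC PE with Bool.T? (lookup (vars C) x)
  ... | yes x∈C = subst P (sym (subst-⊕ (Bool.T-≡ .to x∈C))) (P-⊕ PC PE)
  ... | no  x∉C = subst P (sym (subst-fresh (Bool.¬-not (x∉C ∘ Bool.T-≡ .from)))) PC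
  single : ∀ {x y : Fin _} {b} → P (binary x y b) → P (⁅ x ⁆ △ ⁅ y ⁆ ≐ b)
  single {x} {y} = subst P (cong₂ _≐_ (cong (⁅ x ⁆ △_) (△-identityʳ ⁅ y ⁆)) refl)
  go : ∀ {Ps C} → All P Ps → Subst Ps C → P C
  go (PE ∷ PC ∷ []) unit⊤        = step _ _ _ _ PC PE
  go (PE ∷ PC ∷ []) unit⊥        = step _ _ _ _ PC PE
  go (PE ∷ PC ∷ []) (binary⊥ _)  = step _ _ _ _ PC (single PE)
  go (PE ∷ PC ∷ []) (binary⊤ _)  = step _ _ _ _ PC (single PE)

⊩-⊕ : ∀ {v} {C D : XorClause n} → v ⊩ C → v ⊩ D → v ⊩ (C ⊕ D)
⊩-⊕ {v = v} {C} {D} p q = trans (value-△ v (vars C) (vars D)) (cong₂ _xor_ p q)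

binary-sym : ∀ (x y : Fin n) b → binary x y b ≡ binary y x b
binary-sym x y b = cong₂ _≐_ (△.x∙yz≈y∙xz ⁅ x ⁆ ⁅ y ⁆ Subset.⊥) refl

ternary-rotate : ∀ (x y z : Fin n) b → ternary x y z b ≡ ternary z x y b
ternary-rotate x y z b = cong₂ _≐_
  (trans (cong (⁅ x ⁆ △_) (△.x∙yz≈y∙xz ⁅ y ⁆ ⁅ z ⁆ Subset.⊥))
         (△.x∙yz≈y∙xz ⁅ x ⁆ ⁅ z ⁆ _)) refl

∈-unit : ∀ (x : Fin n) b → x ∈ᶜ unit x b
∈-unit x b = lookup-⨁ {xs = x ∷ []} ([] ∷ []) (here refl)

module _ {P : XorClause n → Set} (closed : Closed Subst P) where

  resolve-unit : ∀ {x b C} → x ∈ᶜ C → P (unit x b) → P C → P (C ⊕ unit x b)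
  resolve-unit {x} {true}  x∈C PE PC = subst P (subst-⊕ x∈C) (closed (PE ∷ PC ∷ []) unit⊤)
  resolve-unit {x} {false} x∈C PE PC = subst P (subst-⊕ x∈C) (closed (PE ∷ PC ∷ []) unit⊥)

  resolve-binary : ∀ {x y b C} → x ≢ y → x ∈ᶜ C → P (binary x y b) → P C → P (C ⊕ binary x y b)
  resolve-binary {x} {y} {b} {C} x≢y x∈C PE PC = subst P
    (trans (subst-⊕ x∈C) (cong (λ S → C ⊕ (⁅ x ⁆ △ S ≐ b)) (sym (△-identityʳ ⁅ y ⁆))))
    (rule b PE)
    where
    rule : ∀ b → P (binary x y b) → P (C [ x / (⁅ y ⁆ , b) ])
    rule true  PE = closed (PE ∷ PC ∷ []) (binary⊤ x≢y)
    rule false PE = closed (PE ∷ PC ∷ []) (binary⊥ x≢y)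

  binary-trans : ∀ {x y z b c} → x ≢ y → y ≢ z → P (binary x y b) → P (binary y z c) →
                 P (binary x z (b xor c))
  binary-trans {x} {y} {z} {b} {c} x≢y y≢z Pxy Pyz = subst P
    (cong₂ _≐_ (trans (cong (_△ ⨁ (y ∷ z ∷ [])) (△.x∙yz≈y∙xz ⁅ x ⁆ ⁅ y ⁆ Subset.⊥))
            (trans (△-cancel ⁅ y ⁆ (⁅ x ⁆ △ Subset.⊥) (⁅ z ⁆ △ Subset.⊥))
                   (cong (_△ ⨁ (z ∷ [])) (△-identityʳ ⁅ x ⁆)))) refl)
    (resolve-binary y≢z (lookup-⨁ ((x≢y ∷ []) ∷ [] ∷ []) (there (here refl))) Pyz Pxy)

  -- Repeated substitution collapses the path to an equation between its ends. At least one edge is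
  -- required: with none, the two ends would coincide and the clause would be empty.
  path-binary : ∀ {k} (x : Fin (suc (suc k)) → Fin n) (c : Fin (suc k) → Bool) → Injective _≡_ _≡_ x →
                All P (path x c) → P (binary (x zero) (x (fromℕ (suc k))) (xorSum c))
  path-binary {zero}  x c inj (Pe ∷ []) = subst (P ∘ binary _ _) (sym (xor-identityʳ (c zero))) Pe
  path-binary {suc k} x c inj (Pe ∷ Ps) =
    binary-trans ((λ ()) ∘ inj) ((λ ()) ∘ inj) Pe
      (path-binary (x ∘ suc) (c ∘ suc) (Fin.suc-injective ∘ inj) Ps)

  -- Each rule of EC is one substitution, preceded in the two path rules by the collapse of the
  -- path. The conclusion is the sum of the premises, so the shared variables cancel.
  Subst-closed⇒EC-closed : Closed EC P
  Subst-closed⇒EC-closed Ps rule = infer rule Ps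
    where
    infer : ∀ {Ps C} → EC Ps C → All P Ps → P C
    infer (conflict {x}) (Pt ∷ Pf ∷ []) =
      subst P (cong₂ _≐_ (△-self (⨁ (x ∷ []))) refl) (resolve-unit (∈-unit x false) Pt Pf)
    infer (unitBinary {x} {y} {a} {b} uniq) (Pu ∷ Pb ∷ []) =
      subst P (cong₂ _≐_ (trans (△-cancel ⁅ x ⁆ (⨁ (y ∷ [])) Subset.⊥) (△-identityʳ _)) (xor-comm b a))
        (resolve-unit (lookup-⨁ uniq (here refl)) Pu Pb)
    infer (unitTernary {x} {y} {z} {a} {b} uniq) (Pu ∷ Pb ∷ []) =
      subst P (cong₂ _≐_ (trans (△-cancel ⁅ x ⁆ (⨁ (y ∷ z ∷ [])) Subset.⊥) (△-identityʳ _)) (xor-comm b a))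
        (resolve-unit (lookup-⨁ uniq (here refl)) Pu Pb)
    infer (pathTernary {zero} _ ((x≢x ∷ _) ∷ _)) _ = contradiction refl x≢x
    infer (pathTernary {suc k} {x} {y} {c} {d} inj uniq@((x≢x′ ∷ _) ∷ _)) Ps
      with Pp , Pt ∷ [] ← All.++⁻ (path x c) Ps =
      subst P (cong₂ _≐_
          (trans (△-cancel ⁅ x zero ⁆ (⁅ x′ ⁆ △ ⨁ (y ∷ [])) (⁅ x′ ⁆ △ Subset.⊥))
          (trans (△-cancel ⁅ x′ ⁆ (⨁ (y ∷ [])) Subset.⊥) (△-identityʳ _)))
          (xor-comm d (xorSum c)))
        (resolve-binary x≢x′ (lookup-⨁ uniq (here refl)) (path-binary x c inj Pp) Pt)
      where x′ = x (fromℕ (suc k))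
    infer (cycleConflict {zero} _ ((x≢x ∷ _) ∷ _) _) _ = contradiction refl x≢x
    infer (cycleConflict {suc k} {x} {c} {d} inj ((x′≢x ∷ _) ∷ _) odd) Ps
      with Pp , Pt ∷ [] ← All.++⁻ (path x c) Ps =
      subst P (cong₂ _≐_ (△-self (⨁ (x zero ∷ x′ ∷ []))) (trans (xor-comm d (xorSum c)) odd))
        (resolve-binary (≢-sym x′≢x) (lookup-⨁ ((≢-sym x′≢x ∷ []) ∷ [] ∷ []) (here refl))
          (path-binary x c inj Pp) (subst P (binary-sym x′ (x zero) d) Pt))
      where x′ = x (fromℕ (suc k))

-- The sum of the clauses of an xor-cycle

tabulate-∷ʳ : (f : Fin (suc k) → X) → tabulate f ≡ tabulate (f ∘ inject₁) ++ [ f (fromℕ k) ]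
tabulate-∷ʳ {zero}  f = refl
tabulate-∷ʳ {suc k} f = cong (f zero ∷_) (tabulate-∷ʳ (f ∘ suc))

⨁-++ : (xs ys : List (Fin n)) → ⨁ (xs ++ ys) ≡ ⨁ xs △ ⨁ ys
⨁-++ []       ys = sym (△-identityˡ _)
⨁-++ (x ∷ xs) ys = trans (cong (⁅ x ⁆ △_) (⨁-++ xs ys)) (sym (△-assoc ⁅ x ⁆ _ _))

-- Consecutive clauses share an inner variable, which cancels; only the two ends of the path
-- survive. For `k = 0` the ends coincide and cancel as well.
Σ⊕-telescope : ∀ (x : Fin (suc k) → Fin n) (y : Fin k → Fin n) (p : Fin k → Bool) →
  Σ⊕ (tabulate λ i → ternary (x (inject₁ i)) (x (suc i)) (y i) (p i))
    ≡ (⁅ x zero ⁆ △ ⁅ x (fromℕ k) ⁆ △ ⨁ (tabulate y) ≐ xorSum p)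
Σ⊕-telescope {zero} x y p = cong₂ _≐_ (begin
  Subset.⊥                                  ≡⟨ △-self ⁅ x zero ⁆ ⟨
  ⁅ x zero ⁆ △ ⁅ x zero ⁆                   ≡⟨ cong (⁅ x zero ⁆ △_) (△-identityʳ _) ⟨
  ⁅ x zero ⁆ △ ⁅ x zero ⁆ △ Subset.⊥        ∎) refl
  where open ≡-Reasoning
Σ⊕-telescope {suc k} x y p = trans
  (cong (ternary (x zero) (x (suc zero)) (y zero) (p zero) ⊕_) (Σ⊕-telescope (x ∘ suc) (y ∘ suc) (p ∘ suc)))
  (cong₂ _≐_ (begin
    (A △ B △ C △ Subset.⊥) △ (B △ D △ Y)  ≡⟨ △-assoc A _ _ ⟩
    A △ ((B △ C △ Subset.⊥) △ (B △ D △ Y)) ≡⟨ cong (A △_) (△-cancel B _ _) ⟩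
    A △ (C △ Subset.⊥) △ (D △ Y)          ≡⟨ cong (λ S → A △ S △ (D △ Y)) (△-identityʳ C) ⟩
    A △ C △ D △ Y                         ≡⟨ cong (A △_) (△.x∙yz≈y∙xz C D Y) ⟩
    A △ D △ C △ Y                         ∎) refl)
  where
  open ≡-Reasoning
  A = ⁅ x zero ⁆
  B = ⁅ x (suc zero) ⁆
  C = ⁅ y zero ⁆
  D = ⁅ x (fromℕ (suc k)) ⁆
  Y = ⨁ (tabulate (y ∘ suc))

module _ {φ : Formula n} (Z : XorCycle φ) where
  open XorCycle Z renaming (k to len)

  -- The inner variables cancel.
  Σ⊕-cycle : Σ⊕ (tabulate clause) ≡ (⨁ (tabulate y) ≐ xorSum p)
  Σ⊕-cycle = begin
    Σ⊕ (tabulate clause)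
      ≡⟨ cong Σ⊕ (tabulate-∷ʳ clause) ⟩
    Σ⊕ (tabulate (clause ∘ inject₁) ++ [ clause (fromℕ len) ])
      ≡⟨ Σ⊕-++ (tabulate (clause ∘ inject₁)) _ ⟩
    Σ⊕ (tabulate (clause ∘ inject₁)) ⊕ (clause (fromℕ len) ⊕ 𝟘)
      ≡⟨ cong₂ _⊕_ (trans (cong Σ⊕ (List.tabulate-cong step)) (Σ⊕-telescope x (y ∘ inject₁) (p ∘ inject₁)))
                   (trans (⊕.identityʳ _) close) ⟩
    (A △ B △ Y ≐ xorSum (p ∘ inject₁)) ⊕ ternary (x zero) (x (fromℕ len)) (y (fromℕ len)) (p (fromℕ len))
      ≡⟨ cong₂ _≐_ (trans (△-cancel A _ _) (△-cancel B _ _)) (sym (xorSum-last p)) ⟩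
    (Y △ ⨁ [ y (fromℕ len) ] ≐ xorSum p)
      ≡⟨ cong₂ _≐_ (trans (sym (⨁-++ (tabulate (y ∘ inject₁)) _)) (cong ⨁ (sym (tabulate-∷ʳ y)))) refl ⟩
    (⨁ (tabulate y) ≐ xorSum p) ∎
    where
    open ≡-Reasoning
    A = ⁅ x zero ⁆
    B = ⁅ x (fromℕ len) ⁆
    Y = ⨁ (tabulate (y ∘ inject₁))

  defect-cycle : ∀ a → defect a (Σ⊕ (tabulate clause)) ≡ xorSum (a ∘ y) xor xorSum p
  defect-cycle a = trans (cong (defect a) Σ⊕-cycle)
    (cong (_xor xorSum p) (trans (value-⨁ a (tabulate y)) (cong (foldr _xor_ false) (List.map-tabulate y a))))

-- Unit propagation on sums of clauses

∈-⊕ˡ : ∀ (C D : XorClause n) {u} → u ∈ᶜ C → lookup (vars D) u ≡ false → u ∈ᶜ (C ⊕ D)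
∈-⊕ˡ C D {u} Cu Du = trans (lookup-△ (vars C) (vars D) u) (cong₂ _xor_ Cu Du)

∈-⊕ʳ : ∀ (C D : XorClause n) {u} → lookup (vars C) u ≡ false → u ∈ᶜ D → u ∈ᶜ (C ⊕ D)
∈-⊕ʳ C D {u} Cu Du = trans (lookup-△ (vars C) (vars D) u) (cong₂ _xor_ Cu Du)

three-elements : ∀ (S : Subset n) {x} → ∣ S ∣ ≡ 3 → lookup S x ≡ true →
                 ∃[ y ] ∃[ z ] S ≡ ⨁ (x ∷ y ∷ z ∷ []) × Unique (x ∷ y ∷ z ∷ [])
three-elements S {x} size Sx
  with T , S≡ , ∣T∣ , T∌x ← split-element S x Sx
  with y , Ty ← ∣S∣>0⇒inhabited T
                  (subst (0 <_) (ℕ.suc-injective (trans (sym size) ∣T∣)) (s≤s z≤n))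
  = y , third-element S size x≢y Sx Sy
  where
  x≢y : x ≢ y
  x≢y refl = contradiction (trans (sym Ty) T∌x) λ ()
  Sy : lookup S y ≡ true
  Sy = trans (cong (λ U → lookup U y) S≡)
         (trans (lookup-△ ⁅ x ⁆ T y) (cong₂ _xor_ (lookup-⁅⁆-≢ (≢-sym x≢y)) Ty))

Unique-rotate : {x y z : X} → Unique (x ∷ y ∷ z ∷ []) → Unique (z ∷ x ∷ y ∷ [])
Unique-rotate ((x≢y ∷ x≢z ∷ []) ∷ (y≢z ∷ []) ∷ [] ∷ []) =
  (≢-sym x≢z ∷ ≢-sym y≢z ∷ []) ∷ (x≢y ∷ []) ∷ [] ∷ []

module Propagation {P : XorClause n → Set} (closed : Closed EC P) where

  -- Unit propagation on C, simulated by P: once all variables of C but u₀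
  -- are assigned by a, the value of u₀ is forced.
  Propagates : XorClause n → Fin n → Set
  Propagates C u₀ = ∀ a → (∀ u → u ≢ u₀ → u ∈ᶜ C → P (unit u (a u))) → defect a C ≡ true →
                    P ⊥-clause ⊎ P (unit u₀ (not (a u₀)))

  clash : ∀ u b → P (unit u b) → P (unit u (not b)) → P ⊥-clause
  clash u true  p q = closed (p ∷ q ∷ []) (conflict {x = u})
  clash u false p q = closed (q ∷ p ∷ []) (conflict {x = u})

  -- Propagation forces `u₀` to differ from `a u₀`. If `u₀` occurs in `C`, this clashes with its
  -- unit. If not, flipping `u₀` leaves `C` violated, so a second propagation forces the opposite
  -- value.
  propagates⇒refutes : ∀ C u₀ → Propagates C u₀ → ∀ a → (∀ u → u ∈ᶜ C → P (unit u (a u))) →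
                       defect a C ≡ true → P ⊥-clause
  propagates⇒refutes C u₀ prop a units odd with prop a (λ u _ → units u) odd
  ... | inj₁ p⊥ = p⊥
  ... | inj₂ p with lookup (vars C) u₀ in Cu₀
  ...   | true  = clash u₀ (a u₀) (units u₀ Cu₀) p
  ...   | false with prop (flip u₀ a) (λ u u≢u₀ u∈C → subst (P ∘ unit u) (sym (flip-≢ a u≢u₀)) (units u u∈C))
                       (trans (defect-flip u₀ a C) (cong₂ _xor_ odd Cu₀))
  ...     | inj₁ p⊥ = p⊥
  ...     | inj₂ q = clash u₀ (not (a u₀)) p (subst (λ b → P (unit u₀ (not b))) (flip-≡ u₀ a) q)

  ternary-unit : ∀ {x y z p} → Unique (x ∷ y ∷ z ∷ []) → P (ternary x y z p) →
                 ∀ a → P (unit y (a y)) → P (unit z (a z)) → defect a (ternary x y z p) ≡ true →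
                 P (unit x (not (a x)))
  ternary-unit {x} {y} {z} {p} uniq Pt a Py Pz odd =
    subst (P ∘ unit x) (bool (a x) (a y) (a z) p (trans (sym (cong (_xor p) (value-⨁ a (x ∷ y ∷ z ∷ [])))) odd))
      (closed (Py ∷ subst P (binary-sym x y _) Pb ∷ []) (unitBinary (y≢x uniq)))
    where
    Pb : P (binary x y (a z xor p))
    Pb = closed (Pz ∷ subst P (ternary-rotate x y z p) Pt ∷ []) (unitTernary (Unique-rotate uniq))
    y≢x : Unique (x ∷ y ∷ z ∷ []) → Unique (y ∷ x ∷ [])
    y≢x ((x≢y ∷ _) ∷ _) = (≢-sym x≢y ∷ []) ∷ [] ∷ []
    bool : ∀ a b c p → (a xor (b xor (c xor false))) xor p ≡ true → b xor (c xor p) ≡ not a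
    bool a b c p eq = begin
      b xor (c xor p)                                   ≡⟨ ternary-xor a b c p ⟩
      a xor ((a xor (b xor (c xor false))) xor p)       ≡⟨ cong (a xor_) eq ⟩
      a xor true                                        ≡⟨ xor-comm a true ⟩
      not a                                             ∎
      where
      open ≡-Reasoning

  ternary-force : ∀ {C} → ∣ vars C ∣ ≡ 3 → P C → ∀ a {x} → x ∈ᶜ C →
                  (∀ u → u ≢ x → u ∈ᶜ C → P (unit u (a u))) → defect a C ≡ true → P (unit x (not (a x)))
  ternary-force {C} size PC a {x} x∈C units odd
    with y , z , eq , uniq@((x≢y ∷ x≢z ∷ []) ∷ _) ← three-elements (vars C) size x∈C =
    ternary-unit uniq (subst P C≡ PC) a
      (units y (≢-sym x≢y) (subst (y ∈ᶜ_) (sym C≡) (lookup-⨁ uniq (there (here refl)))))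
      (units z (≢-sym x≢z) (subst (z ∈ᶜ_) (sym C≡) (lookup-⨁ uniq (there (there (here refl))))))
      (subst (λ D → defect a D ≡ true) C≡ odd)
    where
    C≡ : C ≡ ternary x y z (parity C)
    C≡ = cong₂ _≐_ eq refl

  -- If `u₀` is not in `C`, all three variables are assigned, and forcing any one of them
  -- contradicts its unit.
  propagate-ternary : ∀ {C} → ∣ vars C ∣ ≡ 3 → P C → ∀ u₀ → Propagates C u₀
  propagate-ternary {C} size PC u₀ a units odd with lookup (vars C) u₀ in Cu₀
  ... | true = inj₂ (ternary-force size PC a Cu₀ units odd)
  ... | false with x , x∈C ← ∣S∣>0⇒inhabited (vars C) (subst (0 <_) (sym size) (s≤s z≤n)) =
    inj₁ (clash x (a x) (units′ x x∈C) (ternary-force size PC a x∈C (λ u _ → units′ u) odd))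
    where
    units′ : ∀ u → u ∈ᶜ C → P (unit u (a u))
    units′ u u∈C = units u (λ { refl → contradiction (trans (sym u∈C) Cu₀) λ () }) u∈C

  module _ (C E : XorClause n) {v u₀ : Fin n}
           (C-prop : Propagates C v) (E-prop : Propagates E u₀)
           (v∈E : v ∈ᶜ E) (u₀-outside : u₀ ≡ v ⊎ lookup (vars C) u₀ ≡ false) where

    -- The violated `C` forces `v` to the value opposite to `b v`. With this value `E` is violated
    -- and forces `u₀` in turn. If `u₀` is `v` itself, the two forced values clash, hence `u₀ ≢ v`
    -- in the remaining case.
    propagate-through : ∀ b → (∀ u → u ≢ u₀ → u ≢ v → u ∈ᶜ C → P (unit u (b u))) →
                        (∀ u → u ≢ u₀ → u ≢ v → u ∈ᶜ E → P (unit u (b u))) →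
                        defect b C ≡ true → defect b E ≡ false →
                        P ⊥-clause ⊎ (u₀ ≢ v × P (unit u₀ (not (b u₀))))
    propagate-through b C-units E-units C-odd E-even
      with C-prop b (λ u u≢v u∈C → C-units u (u≢u₀ u≢v u∈C) u≢v u∈C) C-odd
      where
      u≢u₀ : ∀ {u} → u ≢ v → u ∈ᶜ C → u ≢ u₀
      u≢u₀ u≢v u∈C refl =
        [ u≢v , (λ u∉C → contradiction (trans (sym u∈C) u∉C) λ ()) ]′ u₀-outside
    ... | inj₁ p⊥ = inj₁ p⊥
    ... | inj₂ Pv with E-prop (flip v b) E-units′ (trans (defect-flip v b E) (cong₂ _xor_ E-even v∈E))
      where
      E-units′ : ∀ u → u ≢ u₀ → u ∈ᶜ E → P (unit u (flip v b u))
      E-units′ u u≢u₀ u∈E with u Fin.≟ v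
      ... | yes refl = subst (P ∘ unit u) (sym (flip-≡ u b)) Pv
      ... | no u≢v   = subst (P ∘ unit u) (sym (flip-≢ b u≢v)) (E-units u u≢u₀ u≢v u∈E)
    ... | inj₁ p⊥ = inj₁ p⊥
    ... | inj₂ Pu₀ with u₀ Fin.≟ v
    ...   | yes refl = inj₁ (clash u₀ (not (b u₀)) Pv (subst (λ c → P (unit u₀ (not c))) (flip-≡ u₀ b) Pu₀))
    ...   | no u₀≢v  = inj₂ (u₀≢v , subst (λ c → P (unit u₀ (not c))) (flip-≢ b u₀≢v) Pu₀)

    -- Exactly one of `C` and `E` is violated. As `v` occurs in both and carries no unit, its value
    -- may be flipped so that `C` is the violated one.
    propagate-join : ∀ a → v ∈ᶜ C → (∀ u → u ≢ u₀ → u ≢ v → u ∈ᶜ C → P (unit u (a u))) →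
                     (∀ u → u ≢ u₀ → u ≢ v → u ∈ᶜ E → P (unit u (a u))) →
                     defect a C xor defect a E ≡ true →
                     P ⊥-clause ⊎ P (unit u₀ (not (a u₀)))
    propagate-join a v∈C C-units E-units odd with defect a C in aC
    ... | true with propagate-through a C-units E-units aC (Bool.not-injective odd)
    ...   | inj₁ p⊥      = inj₁ p⊥
    ...   | inj₂ (_ , p) = inj₂ p
    propagate-join a v∈C C-units E-units odd | false
      with propagate-through (flip v a)
             (λ u u≢u₀ u≢v u∈C → subst (P ∘ unit u) (sym (flip-≢ a u≢v)) (C-units u u≢u₀ u≢v u∈C))
             (λ u u≢u₀ u≢v u∈E → subst (P ∘ unit u) (sym (flip-≢ a u≢v)) (E-units u u≢u₀ u≢v u∈E))
             (trans (defect-flip v a C) (cong₂ _xor_ aC v∈C))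
             (trans (defect-flip v a E) (cong₂ _xor_ odd v∈E))
    ... | inj₁ p⊥         = inj₁ p⊥
    ... | inj₂ (u₀≢v , p) = inj₂ (subst (λ c → P (unit u₀ (not c))) (flip-≢ a u₀≢v) p)

  propagate-disjoint : ∀ C E → (∀ u → u ∈ᶜ C → ¬ u ∈ᶜ E) →
                       (∀ u → Propagates C u) → (∀ u → Propagates E u) → ∀ u₀ → Propagates (C ⊕ E) u₀
  propagate-disjoint C E disj C-prop E-prop u₀ a units odd with defect a C in aC
  ... | true  = C-prop u₀ a (λ u u≢u₀ u∈C → units u u≢u₀ (∈-⊕ˡ C E u∈C (Bool.¬-not (disj u u∈C)))) aC
  ... | false = E-prop u₀ a (λ u u≢u₀ u∈E → units u u≢u₀ (∈-⊕ʳ C E (Bool.¬-not λ u∈C → disj u u∈C u∈E) u∈E))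
                  (trans (sym (trans (defect-⊕ a C E) (cong (_xor defect a E) aC))) odd)

  -- Only `v` can cancel in the sum, so all other variables keep their units. If `v` occurs in both
  -- parts, propagation starts in one that does not contain `u₀`, or contains it only as `v`, and
  -- passes through `v` to the other. Otherwise the parts are disjoint.
  propagate-⊕ : ∀ C E v → (∀ u → u ∈ᶜ C → u ∈ᶜ E → u ≡ v) →
                (∀ u → Propagates C u) → (∀ u → Propagates E u) → ∀ u₀ → Propagates (C ⊕ E) u₀
  propagate-⊕ C E v common C-prop E-prop u₀ a units odd
    with lookup (vars C) v in Cv | lookup (vars E) v in Ev
  ... | true  | true  = joined
    where
    ∉E : ∀ {u} → u ≢ v → u ∈ᶜ C → lookup (vars E) u ≡ false
    ∉E u≢v u∈C = Bool.¬-not λ u∈E → u≢v (common _ u∈C u∈E)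
    ∉C : ∀ {u} → u ≢ v → u ∈ᶜ E → lookup (vars C) u ≡ false
    ∉C u≢v u∈E = Bool.¬-not λ u∈C → u≢v (common _ u∈C u∈E)
    C-units : ∀ u → u ≢ u₀ → u ≢ v → u ∈ᶜ C → P (unit u (a u))
    C-units u u≢u₀ u≢v u∈C = units u u≢u₀ (∈-⊕ˡ C E u∈C (∉E u≢v u∈C))
    E-units : ∀ u → u ≢ u₀ → u ≢ v → u ∈ᶜ E → P (unit u (a u))
    E-units u u≢u₀ u≢v u∈E = units u u≢u₀ (∈-⊕ʳ C E (∉C u≢v u∈E) u∈E)
    odd′ : defect a C xor defect a E ≡ true
    odd′ = trans (sym (defect-⊕ a C E)) odd
    C-first : u₀ ≡ v ⊎ lookup (vars C) u₀ ≡ false → P ⊥-clause ⊎ P (unit u₀ (not (a u₀)))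
    C-first out = propagate-join C E (C-prop v) (E-prop u₀) Ev out a Cv C-units E-units odd′
    joined : P ⊥-clause ⊎ P (unit u₀ (not (a u₀)))
    joined with u₀ Fin.≟ v
    ... | yes u₀≡v = C-first (inj₁ u₀≡v)
    ... | no  u₀≢v with lookup (vars C) u₀ in Cu₀
    ...   | false = C-first (inj₂ Cu₀)
    ...   | true  = propagate-join E C (E-prop v) (C-prop u₀) Cv (inj₂ (∉E u₀≢v Cu₀)) a Ev E-units C-units
                      (trans (xor-comm (defect a E) (defect a C)) odd′)
  ... | false | _     = propagate-disjoint C E (λ u u∈C u∈E → absurd u∈C u∈E) C-prop E-prop u₀ a units odd
    where
    absurd : ∀ {u} → u ∈ᶜ C → ¬ u ∈ᶜ E
    absurd u∈C u∈E with refl ← common _ u∈C u∈E = contradiction (trans (sym u∈C) Cv) λ ()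
  ... | true  | false = propagate-disjoint C E (λ u u∈C u∈E → absurd u∈C u∈E) C-prop E-prop u₀ a units odd
    where
    absurd : ∀ {u} → u ∈ᶜ C → ¬ u ∈ᶜ E
    absurd u∈C u∈E with refl ← common _ u∈C u∈E = contradiction (trans (sym u∈E) Ev) λ ()

  module _ {φ : Formula n} (Z : XorCycle φ) where
    open XorCycle Z renaming (k to len)

    -- The units of all outer variables but the last turn the step clauses into a path of binary
    -- equations, and the path rule with the closing clause yields the last outer variable. Its
    -- value differs from that of `a` because the sum of the cycle is violated.
    propagate-cycle :
      (∀ i → P (clause i)) → ∀ a → (∀ i → P (unit (y (inject₁ i)) (a (y (inject₁ i))))) →
      defect a (Σ⊕ (tabulate clause)) ≡ true → P (unit (y (fromℕ len)) (not (a (y (fromℕ len)))))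
    propagate-cycle Pclause a units odd =
      subst (P ∘ unit (y (fromℕ len))) value≡
        (closed (All.++⁺ (All.tabulate⁺ Pbinary) (subst P close (Pclause (fromℕ len)) ∷ []))
                (pathTernary {x = x} {c = c} xDistinct closeUnique))
      where
      c : Fin len → Bool
      c i = a (y (inject₁ i)) xor p (inject₁ i)
      Pbinary : ∀ i → P (binary (x (inject₁ i)) (x (suc i)) (c i))
      Pbinary i = closed
        (units i ∷ subst P (trans (step i) (ternary-rotate _ _ _ _)) (Pclause (inject₁ i)) ∷ [])
        (unitTernary (Unique-rotate (stepUnique i)))
      value≡ : xorSum c xor p (fromℕ len) ≡ not (a (y (fromℕ len)))
      value≡ = begin
        xorSum c xor pₘ                      ≡⟨ cong (_xor pₘ) (xorSum-xor (a ∘ y ∘ inject₁) (p ∘ inject₁)) ⟩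
        (A xor Q) xor pₘ                     ≡⟨ cycle-xor A Q aₘ pₘ ⟩
        aₘ xor ((A xor aₘ) xor (Q xor pₘ))   ≡⟨ cong (aₘ xor_) (cong₂ _xor_ (xorSum-last (a ∘ y)) (xorSum-last p)) ⟨
        aₘ xor (xorSum (a ∘ y) xor xorSum p) ≡⟨ cong (aₘ xor_) (trans (sym (defect-cycle Z a)) odd) ⟩
        aₘ xor true                          ≡⟨ xor-comm aₘ true ⟩
        not aₘ                               ∎
        where
        open ≡-Reasoning
        pₘ = p (fromℕ len)
        aₘ = a (y (fromℕ len))
        A = xorSum (a ∘ y ∘ inject₁)
        Q = xorSum (p ∘ inject₁)

-- Growing a connected set of clauses

_∈ᶜ?_ : ∀ u (C : XorClause n) → Dec (u ∈ᶜ C)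
u ∈ᶜ? C = lookup (vars C) u Bool.≟ true

lookup-∷-injective : ∀ {x : X} {xs : Vec X m} → (∀ i → x ≢ lookup xs i) →
                     Injective _≡_ _≡_ (lookup xs) → Injective _≡_ _≡_ (lookup (x ∷ xs))
lookup-∷-injective x∉xs inj {zero}  {zero}  _  = refl
lookup-∷-injective x∉xs inj {zero}  {suc j} eq = contradiction eq (x∉xs j)
lookup-∷-injective x∉xs inj {suc i} {zero}  eq = contradiction (sym eq) (x∉xs i)
lookup-∷-injective x∉xs inj {suc i} {suc j} eq = cong suc (inj eq)

shared-unique : ∀ {F : Formula n} → Is3XorNF F → ∀ {C D u v} → C ∈ F → D ∈ F → C ≢ D →
                u ∈ᶜ C → u ∈ᶜ D → v ∈ᶜ C → v ∈ᶜ D → u ≡ v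
shared-unique nf {C} {D} C∈F D∈F C≢D Cu Du Cv Dv =
  ∣S∣≤1⇒≡ (vars C ∩ vars D) (Is3XorNF.shareAtMost1 nf C∈F D∈F C≢D) (both Cu Du) (both Cv Dv)
  where
  both : ∀ {u} → u ∈ᶜ C → u ∈ᶜ D → lookup (vars C ∩ vars D) u ≡ true
  both {u} Cu Du = trans (Vec.lookup-zipWith _∧_ u (vars C) (vars D)) (cong₂ _∧_ Cu Du)

inject₁≢suc : (i : Fin k) → inject₁ i ≢ suc i
inject₁≢suc (suc i) eq = inject₁≢suc i (Fin.suc-injective eq)

module Walks {n : ℕ} (v : Fin n) (D : XorClause n) where

  -- A walk from D (last entry) that never links through v.  Each link occurs in no
  -- clause before the two it joins, so that the links are distinct.
  data Walk : Vec (Fin n) m → Vec (XorClause n) (suc m) → Set where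
    start : Walk [] (D ∷ [])
    step  : ∀ {zs : Vec (Fin n) m} {E Es} z E′ → Walk zs (E ∷ Es) → z ∈ᶜ E → z ∈ᶜ E′ → z ≢ v →
            (∀ i → ¬ z ∈ᶜ lookup Es i) → (∀ i → E′ ≢ lookup (E ∷ Es) i) →
            Walk (z ∷ zs) (E′ ∷ E ∷ Es)

  -- The part of a walk from `D` to the first clause containing `z`. No earlier clause contains `z`,
  -- so `z` can be the next link; `origin` keeps the clauses within the old walk.
  record Truncated (z : Fin n) (Es : Vec (XorClause n) m) : Set where
    field
      {len}  : ℕ
      {zs′}  : Vec (Fin n) len
      head   : XorClause n
      {Es′}  : Vec (XorClause n) len
      walk   : Walk zs′ (head ∷ Es′)
      z∈head : z ∈ᶜ head
      z∉tail : ∀ i → ¬ z ∈ᶜ lookup Es′ i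
      origin : ∀ i → ∃[ j ] lookup (head ∷ Es′) i ≡ lookup Es j

  truncate : ∀ {zs : Vec (Fin n) m} {Es} → Walk zs Es → ∀ z i → z ∈ᶜ lookup Es i → Truncated z Es
  truncate start z zero z∈D = record
    { head = D ; walk = start ; z∈head = z∈D ; z∉tail = λ () ; origin = λ i → i , refl }
  truncate w@(step {E = E} {Es} _ E′ w′ _ _ _ _ _) z i z∈Eᵢ
    with Fin.any? (λ j → z ∈ᶜ? lookup (E ∷ Es) j)
  ... | yes (j , z∈Eⱼ) = record
    { head = head ; walk = walk ; z∈head = z∈head ; z∉tail = z∉tail
    ; origin = λ i → let j , eq = origin i in suc j , eq }
    where open Truncated (truncate w′ z j z∈Eⱼ)
  ... | no z∉ with i
  ...   | zero  = record
    { head = E′ ; walk = w ; z∈head = z∈Eᵢ ; z∉tail = λ j z∈Eⱼ → z∉ (j , z∈Eⱼ) ; origin = λ i → i , refl }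
  ...   | suc j = contradiction (j , z∈Eᵢ) z∉

  link-later : ∀ {zs : Vec (Fin n) m} {E Es} → Walk zs (E ∷ Es) → ∀ i → lookup zs i ∈ᶜ lookup Es i
  link-later (step z E′ w z∈E _ _ _ _) zero    = z∈E
  link-later (step _ _  w _   _ _ _ _) (suc i) = link-later w i

  link-earlier : ∀ {zs : Vec (Fin n) m} {E Es} → Walk zs (E ∷ Es) →
                 ∀ i → lookup zs i ∈ᶜ lookup (E ∷ Es) (inject₁ i)
  link-earlier (step z E′ w _ z∈E′ _ _ _) zero    = z∈E′
  link-earlier (step _ _  w _ _    _ _ _) (suc i) = link-earlier w i

  link≢v : ∀ {zs : Vec (Fin n) m} {Es} → Walk zs Es → ∀ i → v ≢ lookup zs i
  link≢v (step _ _ w _ _ z≢v _ _) zero    = ≢-sym z≢v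
  link≢v (step _ _ w _ _ _   _ _) (suc i) = link≢v w i

  -- Every earlier link occurs in one of the clauses that the newest link avoids.
  links-injective : ∀ {zs : Vec (Fin n) m} {Es} → Walk zs Es → Injective _≡_ _≡_ (lookup zs)
  links-injective start {()}
  links-injective (step z _ w _ _ _ z∉Es _) =
    lookup-∷-injective (λ { i refl → z∉Es i (link-later w i) }) (links-injective w)

  clauses-injective : ∀ {zs : Vec (Fin n) m} {Es} → Walk zs Es → Injective _≡_ _≡_ (lookup Es)
  clauses-injective start {zero} {zero} _ = refl
  clauses-injective (step _ _ w _ _ _ _ E′∉) = lookup-∷-injective E′∉ (clauses-injective w)

  walk-end : ∀ {zs : Vec (Fin n) m} {Es} → Walk zs Es → lookup Es (fromℕ m) ≡ D
  walk-end start                  = refl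
  walk-end (step _ _ w _ _ _ _ _) = walk-end w

  module _ {F : Formula n} (nf : Is3XorNF F) (D∈F : D ∈ F) (v∈D : v ∈ᶜ D)
           {C : XorClause n} (C∈F : C ∈ F) (v∈C : v ∈ᶜ C) where

    -- The cycle runs from `C` through `c` along the walk back to `D`, and from `D` to `C` through
    -- `v`. A walk of length zero cannot occur, since `C` and `D` would share both `c` and `v`.
    close-walk : ∀ {zs : Vec (Fin n) m} {E Es} → Walk zs (E ∷ Es) → (∀ i → lookup (E ∷ Es) i ∈ F) →
                 (∀ i → C ≢ lookup (E ∷ Es) i) → ∀ c → c ∈ᶜ C → c ∈ᶜ E → c ≢ v →
                 (∀ i → ¬ c ∈ᶜ lookup Es i) →
                 Σ[ Z ∈ XorCycle F ] XorCycle.clause Z (fromℕ _) ≡ D × XorCycle.x Z zero ≡ v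
    close-walk start _ C≢ c c∈C c∈D c≢v _ =
      contradiction (shared-unique nf {C} {D} C∈F D∈F (C≢ zero) c∈C c∈D v∈C v∈D) c≢v
    close-walk {m = suc m} {zs} {E} {Es} w@(step _ _ _ _ _ _ _ _) Es⊆F C≢ c c∈C c∈E c≢v c∉Es = Z , walk-end w , refl
      where
      k′ = suc (suc m)
      xs : Fin (suc k′) → Fin n
      xs = lookup (v ∷ c ∷ zs)
      clauses : Fin (suc k′) → XorClause n
      clauses = lookup (C ∷ E ∷ Es)
      xs-injective : Injective _≡_ _≡_ xs
      xs-injective = lookup-∷-injective
        (λ { zero → ≢-sym c≢v ; (suc i) → link≢v w i })
        (lookup-∷-injective (λ { i refl → c∉Es i (link-later w i) }) (links-injective w))
      clauses∈F : ∀ i → clauses i ∈ F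
      clauses∈F zero    = C∈F
      clauses∈F (suc i) = Es⊆F i
      left : ∀ i → xs (inject₁ i) ∈ᶜ clauses (inject₁ i)
      left zero          = v∈C
      left (suc zero)    = c∈E
      left (suc (suc i)) = link-later w (inject₁ i)
      right : ∀ i → xs (suc i) ∈ᶜ clauses (inject₁ i)
      right zero    = c∈C
      right (suc i) = link-earlier w i
      IsStep : Fin (suc k′) → Fin k′ → Fin n → Set
      IsStep j i y = clauses j ≡ ternary (xs j) (xs (suc i)) y (parity (clauses j)) ×
                     Unique (xs j ∷ xs (suc i) ∷ y ∷ [])
      IsClose : Fin (suc k′) → Fin n → Set
      IsClose j y = clauses j ≡ ternary v (xs j) y (parity (clauses j)) × Unique (v ∷ xs j ∷ y ∷ [])
      v∈last : v ∈ᶜ clauses (fromℕ k′)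
      v∈last = subst (v ∈ᶜ_) (sym (walk-end w)) v∈D
      -- The outer variable is chosen once for each position; the equations on `j` allow both the
      -- step and the closing property to be stated for that choice.
      third : ∀ j → ∃[ y ] (∀ i → j ≡ inject₁ i → IsStep j i y) × (j ≡ fromℕ k′ → IsClose j y)
      third j with view j
      ... | ‵inject₁ i
        with y , eq , uniq ← third-element (vars (clauses (inject₁ i)))
                               (Is3XorNF.threeVars nf (clauses∈F (inject₁ i)))
                               (inject₁≢suc i ∘ xs-injective {inject₁ i} {suc i}) (left i) (right i)
        = y
        , (λ i′ eq′ → subst (λ i″ → IsStep (inject₁ i) i″ y) (Fin.inject₁-injective eq′) (cong₂ _≐_ eq refl , uniq))
        , (λ eq′ → contradiction (sym eq′) Fin.fromℕ≢inject₁)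
      ... | ‵fromℕ
        with y , eq , uniq ← third-element (vars (clauses (fromℕ k′)))
                               (Is3XorNF.threeVars nf (clauses∈F (fromℕ k′)))
                               ((λ ()) ∘ xs-injective {zero} {fromℕ k′}) v∈last (link-later w (fromℕ m))
        = y , (λ i eq′ → contradiction eq′ Fin.fromℕ≢inject₁) , (λ _ → cong₂ _≐_ eq refl , uniq)
      Z : XorCycle F
      Z = record
        { k = k′
        ; length≥3 = s≤s (s≤s (s≤s z≤n))
        ; x = xs
        ; y = λ i → proj₁ (third i)
        ; p = parity ∘ clauses
        ; clause = clauses
        ; clause∈φ = clauses∈F
        ; clauseDistinct = lookup-∷-injective C≢ (clauses-injective w)
        ; xDistinct = xs-injective
        ; step = λ i → proj₁ (proj₁ (proj₂ (third (inject₁ i))) i refl)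
        ; stepUnique = λ i → proj₂ (proj₁ (proj₂ (third (inject₁ i))) i refl)
        ; close = proj₁ (proj₂ (proj₂ (third (fromℕ k′))) refl)
        ; closeUnique = proj₂ (proj₂ (proj₂ (third (fromℕ k′))) refl)
        }

-- Either a split at one variable or a cycle

extract : ∀ {x : X} {xs} → x ∈ xs → ∃[ ys ] xs ↭ x ∷ ys
extract x∈xs with ys , zs , refl ← Mem.∈-∃++ x∈xs = ys ++ zs , shift _ ys zs

Unique-resp-↭ : ∀ {xs ys : List X} → xs ↭ ys → Unique xs → Unique ys
Unique-resp-↭ xs↭ys = Permutationₛ.Unique-resp-↭ (setoid _) (↭⇒↭ₛ xs↭ys)

Unique-++⁻ : ∀ {xs ys : List X} → Unique (xs ++ ys) → ∀ {x} → x ∈ xs → ¬ x ∈ ys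
Unique-++⁻ (x∉ ∷ uniq) (here refl) x∈ys = All.lookup x∉ (Mem.∈-++⁺ʳ _ x∈ys) refl
Unique-++⁻ (_  ∷ uniq) (there x∈xs)     = Unique-++⁻ uniq x∈xs

record Split (F : Formula n) : Set where
  field
    left right     : Formula n
    decomposition  : F ↭ left ++ right
    left-nonempty  : 0 < length left
    right-nonempty : 0 < length right
    cut            : Fin n
    common         : ∀ {C E u} → C ∈ left → E ∈ right → u ∈ᶜ C → u ∈ᶜ E → u ≡ cut

module Grow {F : Formula n} (nf : Is3XorNF F) (unique : Unique F)
            {D C : XorClause n} (D∈F : D ∈ F) (C∈F : C ∈ F)
            {v : Fin n} (v∈D : v ∈ᶜ D) (v∈C : v ∈ᶜ C) where
  open Walks v D

  -- The closing clause determines which outer variable the path rule derives, and `v` as an inner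
  -- variable is what the partition can contradict.
  CycleThrough : Set
  CycleThrough = Σ[ Z ∈ XorCycle F ] XorCycle.clause Z (fromℕ _) ≡ D × XorCycle.x Z zero ≡ v

  record Reached (K : Formula n) (E : XorClause n) : Set where
    field
      {len}  : ℕ
      {zs}   : Vec (Fin n) len
      {Es}   : Vec (XorClause n) len
      walk   : Walk zs (E ∷ Es)
      inside : ∀ i → lookup (E ∷ Es) i ∈ K

  Linked : XorClause n → XorClause n → Set
  Linked E E′ = ∃[ z ] z ∈ᶜ E × z ∈ᶜ E′ × z ≢ v

  Linked? : ∀ E E′ → Dec (Linked E E′)
  Linked? E E′ = Fin.any? λ z → z ∈ᶜ? E ×-dec z ∈ᶜ? E′ ×-dec ¬? (z Fin.≟ v)

  ¬Linked⇒≡ : ∀ {E E′ u} → ¬ Linked E E′ → u ∈ᶜ E → u ∈ᶜ E′ → u ≡ v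
  ¬Linked⇒≡ {u = u} ¬linked u∈E u∈E′ with u Fin.≟ v
  ... | yes u≡v = u≡v
  ... | no  u≢v = contradiction (u , u∈E , u∈E′ , u≢v) ¬linked

  module _ {K : Formula n} where

    reached-truncate : ∀ {E z} → Reached K E → z ∈ᶜ E →
      Σ[ E′ ∈ XorClause n ] Σ[ r ∈ Reached K E′ ] z ∈ᶜ E′ × (∀ i → ¬ z ∈ᶜ lookup (Reached.Es r) i)
    reached-truncate {z = z} r z∈E =
      head , record { walk = T.walk ; inside = λ i → let j , eq = origin i in subst (_∈ K) (sym eq) (inside j) }
           , z∈head , z∉tail
      where
      open Reached r
      module T = Truncated (truncate walk z zero z∈E)
      open T hiding (walk; len)

    -- The walk is truncated at the first clause containing the link, so that the link is fresh;
    -- `E′` is new to the walk because it lies outside `K`.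
    reached-extend : ∀ {E E′} → ¬ E′ ∈ K → Reached K E → Linked E E′ → Reached (E′ ∷ K) E′
    reached-extend {E} {E′} E′∉K r (z , z∈E , z∈E′ , z≢v)
      with E″ , r″ , z∈E″ , z∉tail ← reached-truncate r z∈E = record
      { walk   = step z E′ walk z∈E″ z∈E′ z≢v z∉tail (λ i E′≡ → E′∉K (subst (_∈ K) (sym E′≡) (inside i)))
      ; inside = λ { zero → here refl ; (suc i) → there (inside i) }
      }
      where open Reached r″

    reached-close : (∀ {E} → E ∈ K → E ∈ F) → ¬ C ∈ K → ∀ {E} → Reached K E → Linked E C → CycleThrough
    reached-close K⊆F C∉K r (c , c∈E , c∈C , c≢v)
      with E″ , r″ , c∈E″ , c∉tail ← reached-truncate r c∈E =
      close-walk nf D∈F v∈D C∈F v∈C walk (K⊆F ∘ inside) (λ i C≡ → C∉K (subst (_∈ K) (sym C≡) (inside i)))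
        c c∈C c∈E″ c≢v c∉tail
      where open Reached r″

  -- `K` holds the clauses reached from `D` by walks inside `K`, and `m` bounds the remainder `R`
  -- for termination. A link from `K` to `C` closes a cycle; a link to `R` enlarges `K`; with
  -- neither, `K` shares only `v` with `C ∷ R`.
  grow : ∀ m K R → length R ≤ m → F ↭ C ∷ K ++ R → 0 < length K → (∀ {E} → E ∈ K → Reached K E) →
         Split F ⊎ CycleThrough
  grow m K R ∣R∣≤m F↭ K≢∅ reached with Any.any? (λ E → Linked? E C) K
  ... | yes found with E , E∈K , linked ← find found =
    inj₂ (reached-close K⊆F C∉K (reached E∈K) linked)
    where
    K⊆F : ∀ {E} → E ∈ K → E ∈ F
    K⊆F E∈K = ∈-resp-↭ (↭-sym F↭) (there (Mem.∈-++⁺ˡ E∈K))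
    C∉K : ¬ C ∈ K
    C∉K C∈K with C∉ ∷ _ ← Unique-resp-↭ F↭ unique = All.lookup C∉ (Mem.∈-++⁺ˡ C∈K) refl
  ... | no K∌C with Any.any? (λ E′ → Any.any? (λ E → Linked? E E′) K) R
  ...   | no K∌R = inj₁ record
    { left = K ; right = C ∷ R ; cut = v
    ; decomposition  = ↭-trans F↭ (↭-sym (shift C K R))
    ; left-nonempty  = K≢∅
    ; right-nonempty = s≤s z≤n
    ; common = λ { {E} {u = u} E∈K (here refl)  u∈E u∈C → ¬Linked⇒≡ {E} {C} (K∌C ∘ lose E∈K) u∈E u∈C
                 ; {E} {E′} {u} E∈K (there E′∈R) u∈E u∈E′ →
                     ¬Linked⇒≡ {E} {E′} (K∌R ∘ lose E′∈R ∘ lose E∈K) u∈E u∈E′ }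
    }
  ...   | yes found
    with E′ , E′∈R , found′ ← find found
    with E , E∈K , linked ← find found′
    with R′ , R↭ ← extract E′∈R
    = continue m ∣R∣≤m
    where
    F↭′ : F ↭ C ∷ (E′ ∷ K) ++ R′
    F↭′ = ↭-trans F↭ (↭-prep C (↭-trans (++⁺ˡ K R↭) (shift E′ K R′)))
    E′∉K : ¬ E′ ∈ K
    E′∉K E′∈K with _ ∷ uniq ← Unique-resp-↭ F↭ unique = Unique-++⁻ uniq E′∈K E′∈R
    reached′ : ∀ {E} → E ∈ E′ ∷ K → Reached (E′ ∷ K) E
    reached′ (here refl)  = reached-extend E′∉K (reached E∈K) linked
    reached′ (there E∈K′) = record { walk = walk ; inside = there ∘ inside }
      where open Reached (reached E∈K′)
    continue : ∀ m → length R ≤ m → Split F ⊎ CycleThrough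
    continue m ∣R∣≤m with subst (_≤ m) (↭-length R↭) ∣R∣≤m
    continue (suc m) _ | s≤s ∣R′∣≤m = grow m (E′ ∷ K) R′ ∣R′∣≤m F↭′ (s≤s z≤n) reached′

  split-or-cycle : D ≢ C → Split F ⊎ CycleThrough
  split-or-cycle D≢C
    with R , F↭ ← extract C∈F
    with ∈-resp-↭ F↭ D∈F
  ... | here D≡C = contradiction D≡C D≢C
  ... | there D∈R with R′ , R↭ ← extract D∈R =
    grow (length R′) [ D ] R′ ℕ.≤-refl (↭-trans F↭ (↭-prep C R↭)) (s≤s z≤n)
      λ { (here refl) → record { walk = start ; inside = λ { zero → here refl } } }

-- Passing to subsets of the clauses

Unique-resp-⊆ : ∀ {xs ys : List X} → xs ⊆ ys → Unique ys → Unique xs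
Unique-resp-⊆ []            []          = []
Unique-resp-⊆ (_ ∷ʳ xs⊆ys)  (_ ∷ uniq)  = Unique-resp-⊆ xs⊆ys uniq
Unique-resp-⊆ (refl ∷ xs⊆ys) (x∉ ∷ uniq) = Sublist.All-resp-⊆ xs⊆ys x∉ ∷ Unique-resp-⊆ xs⊆ys uniq

⊆-++⁻ : ∀ (ys : List X) {xs zs} → xs ⊆ ys ++ zs →
        ∃[ xs₁ ] ∃[ xs₂ ] xs ≡ xs₁ ++ xs₂ × xs₁ ⊆ ys × xs₂ ⊆ zs
⊆-++⁻ []       xs⊆zs = [] , _ , refl , [] , xs⊆zs
⊆-++⁻ (y ∷ ys) (_ ∷ʳ xs⊆) with xs₁ , xs₂ , eq , p , q ← ⊆-++⁻ ys xs⊆ =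
  xs₁ , xs₂ , eq , y ∷ʳ p , q
⊆-++⁻ (y ∷ ys) (refl ∷ xs⊆) with xs₁ , xs₂ , eq , p , q ← ⊆-++⁻ ys xs⊆ =
  y ∷ xs₁ , xs₂ , cong (y ∷_) eq , refl ∷ p , q

complement : ∀ {xs zs : List X} → Unique zs → (∀ {x} → x ∈ zs → x ∈ xs) → ∃[ ys ] xs ↭ zs ++ ys
complement {xs = xs} [] _ = xs , ↭-refl
complement {zs = z ∷ zs} (z∉zs ∷ uniq) zs⊆xs with ys , xs↭ ← extract (zs⊆xs (here refl)) =
  let rs , ys↭ = complement uniq zs⊆ys in rs , ↭-trans xs↭ (↭-prep z ys↭)
  where
  zs⊆ys : ∀ {x} → x ∈ zs → x ∈ ys
  zs⊆ys x∈zs with ∈-resp-↭ xs↭ (zs⊆xs (there x∈zs))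
  ... | here refl   = contradiction refl (All.lookup z∉zs x∈zs)
  ... | there x∈ys = x∈ys

Σ⊕-↭ : ∀ {F G : Formula n} → F ↭ G → Σ⊕ F ≡ Σ⊕ G
Σ⊕-↭ {n} F↭G = Permutationₛ.foldr-commMonoid (setoid (XorClause n)) ⊕-isCommutativeMonoid (↭⇒↭ₛ F↭G)

_≟ᶜ_ : DecidableEquality (XorClause n)
(S ≐ p) ≟ᶜ (T ≐ q) = map′ (λ (S≡T , p≡q) → cong₂ _≐_ S≡T p≡q) (λ { refl → refl , refl })
                          (Vec.≡-dec Bool._≟_ S T ×-dec p Bool.≟ q)

Is3XorNF-⊆ : ∀ {F φ : Formula n} → (∀ {C} → C ∈ F → C ∈ φ) → Is3XorNF φ → Is3XorNF F
Is3XorNF-⊆ F⊆φ nf = record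
  { threeVars    = threeVars ∘ F⊆φ
  ; shareAtMost1 = λ C∈F D∈F → shareAtMost1 (F⊆φ C∈F) (F⊆φ D∈F)
  }
  where open Is3XorNF nf

XorCycle-⊆ : ∀ {F φ : Formula n} → (∀ {C} → C ∈ F → C ∈ φ) → XorCycle F → XorCycle φ
XorCycle-⊆ F⊆φ Z = record
  { XorCycle Z using (k; length≥3; x; y; p; clause; clauseDistinct; xDistinct; step; stepUnique; close; closeUnique)
  ; clause∈φ = F⊆φ ∘ XorCycle.clause∈φ Z
  }

outer∈clause : ∀ {φ : Formula n} (Z : XorCycle φ) i → XorCycle.y Z i ∈ᶜ XorCycle.clause Z i
outer∈clause Z i with view i
... | ‵fromℕ     = subst (_ ∈ᶜ_) (sym close) (lookup-⨁ closeUnique (there (there (here refl))))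
  where open XorCycle Z
... | ‵inject₁ j = subst (_ ∈ᶜ_) (sym (step j)) (lookup-⨁ (stepUnique j) (there (there (here refl))))
  where open XorCycle Z

-- Induction on the set of clauses

module Deduction {φ : Formula n} (nf : Is3XorNF φ) (partition : CyclePartitionable φ)
                 {P : XorClause n → Set} (closed : Closed EC P) (Pφ : ∀ {C} → C ∈ φ → P C) where
  open CyclePartitionable partition
  open Propagation closed

  -- The form in which cycle-partitionability enters the induction: such a variable would lie in
  -- both `Vin` and `Vout`.
  inner-outer-disjoint : ∀ (Z Z′ : XorCycle φ) i j → XorCycle.x Z i ≢ XorCycle.y Z′ j
  inner-outer-disjoint Z Z′ i j eq = contradiction (trans (sym in-both) (lookup-⊥ u)) λ ()
    where
    u = XorCycle.y Z′ j
    in-both : lookup Subset.⊥ u ≡ true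
    in-both = begin
      lookup Subset.⊥ u                ≡⟨ cong (λ S → lookup S u) disjoint ⟨
      lookup (Vin ∩ Vout) u            ≡⟨ Vec.lookup-zipWith _∧_ u Vin Vout ⟩
      lookup Vin u ∧ lookup Vout u     ≡⟨ cong₂ _∧_ (Vec.[]=⇒lookup (subst (Subset._∈ Vin) eq (inner Z i)))
                                                    (Vec.[]=⇒lookup (outer Z′ j)) ⟩
      true                             ∎
      where open ≡-Reasoning

  SumPropagates : Formula n → Set
  SumPropagates F = ∀ u₀ → Propagates (Σ⊕ F) u₀

  module _ {F : Formula n} (unique : Unique F) (F⊆φ : ∀ {C} → C ∈ F → C ∈ φ)
           (IH : ∀ {G} → length G < length F → Unique G → (∀ {C} → C ∈ G → C ∈ φ) → SumPropagates G) where

    -- Both parts are smaller because neither is empty. Their sums share at most the cut, since a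
    -- variable of a sum occurs in a summand.
    propagate-split : Split F → SumPropagates F
    propagate-split S u₀ = subst (λ C → Propagates C u₀)
      (sym (trans (Σ⊕-↭ decomposition) (Σ⊕-++ left right)))
      (propagate-⊕ (Σ⊕ left) (Σ⊕ right) cut common′
        (IH left<  (Unique-resp-⊆ (Sublist.++⁺ʳ right ⊆-refl) unique′) (F⊆φ ∘ ∈F ∘ Mem.∈-++⁺ˡ))
        (IH right< (Unique-resp-⊆ (Sublist.++⁺ˡ left ⊆-refl) unique′) (F⊆φ ∘ ∈F ∘ Mem.∈-++⁺ʳ left))
        u₀)
      where
      open Split S
      unique′ = Unique-resp-↭ decomposition unique
      ∈F : ∀ {C} → C ∈ left ++ right → C ∈ F
      ∈F = ∈-resp-↭ (↭-sym decomposition)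
      size : length F ≡ length left + length right
      size = trans (↭-length decomposition) (List.length-++ left)
      left< : length left < length F
      left< = subst (length left <_) (sym size) (ℕ.m<m+n (length left) right-nonempty)
      right< : length right < length F
      right< = subst (length right <_) (sym size) (ℕ.m<n+m (length right) left-nonempty)
      common′ : ∀ u → u ∈ᶜ Σ⊕ left → u ∈ᶜ Σ⊕ right → u ≡ cut
      common′ u u∈L u∈R
        with C , C∈L , u∈C ← ∈Σ⊕⁻ left u∈L
        with E , E∈R , u∈E ← ∈Σ⊕⁻ right u∈R = common C∈L E∈R u∈C u∈E

    module _ (u₀ : Fin n) (Z : XorCycle F)
             (outer-fresh : ∀ i {E} → E ∈ F → XorCycle.y Z i ∈ᶜ E → E ≡ XorCycle.clause Z i)
             (u₀-last : ∀ {E} → E ∈ F → u₀ ∈ᶜ E → u₀ ∈ᶜ XorCycle.clause Z (fromℕ _)) where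
      open XorCycle Z renaming (k to len)

      -- The variable occurs in a single clause of `F`, so nothing cancels it.
      outer∈Σ⊕ : ∀ i → y i ∈ᶜ Σ⊕ F
      outer∈Σ⊕ i with R , F↭ ← extract (clause∈φ i) =
        subst (y i ∈ᶜ_) (sym (Σ⊕-↭ F↭)) (∈-⊕ˡ (clause i) (Σ⊕ R) (outer∈clause Z i) (Bool.¬-not y∉R))
        where
        y∉R : ¬ y i ∈ᶜ Σ⊕ R
        y∉R y∈ΣR
          with E , E∈R , y∈E ← ∈Σ⊕⁻ R y∈ΣR
          with refl ← outer-fresh i (∈-resp-↭ (↭-sym F↭) (there E∈R)) y∈E
          with c∉R ∷ _ ← Unique-resp-↭ F↭ unique = All.lookup c∉R E∈R refl

      -- Otherwise this variable would also occur in the closing clause, against its freshness.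
      -- Hence all outer variables that the path rule consumes have units.
      outer≢u₀ : ∀ i → y (inject₁ i) ≢ u₀
      outer≢u₀ i refl = Fin.fromℕ≢inject₁ (clauseDistinct
        (outer-fresh (inject₁ i) (clause∈φ (fromℕ len))
          (u₀-last (clause∈φ (inject₁ i)) (outer∈clause Z (inject₁ i)))))

      -- The sum of the cycle consists of outer variables absent from the rest `R`, so nothing
      -- cancels between the two sums and exactly one of them is violated. If it is the cycle, its
      -- last outer variable is forced, and this is `u₀` or clashes with its unit; if it is `R`, the
      -- induction hypothesis applies.
      propagate-around : Propagates (Σ⊕ F) u₀
      propagate-around a units odd
        with R , F↭ ← complement {zs = tabulate clause} (Unique.tabulate⁺ clauseDistinct)
                        (λ C∈Z → let i , eq = Mem.∈-tabulate⁻ {f = clause} C∈Z in subst (_∈ F) (sym eq) (clause∈φ i))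
        = cases (defect a ΣZ) refl
        where
        ΣZ = Σ⊕ (tabulate clause)
        ΣF≡ : Σ⊕ F ≡ ΣZ ⊕ Σ⊕ R
        ΣF≡ = trans (Σ⊕-↭ F↭) (Σ⊕-++ (tabulate clause) R)
        unique′ = Unique-resp-↭ F↭ unique
        R⊆F : ∀ {C} → C ∈ R → C ∈ F
        R⊆F C∈R = ∈-resp-↭ (↭-sym F↭) (Mem.∈-++⁺ʳ (tabulate clause) C∈R)
        R< : length R < length F
        R< = subst (length R <_) (sym (trans (↭-length F↭) (List.length-++ (tabulate clause))))
               (ℕ.m<n+m (length R) (s≤s z≤n))
        ∉ΣZ : ∀ u → u ∈ᶜ Σ⊕ R → ¬ u ∈ᶜ ΣZ
        ∉ΣZ u u∈ΣR u∈ΣZ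
          with i , refl ← Mem.∈-tabulate⁻ {f = y} (lookup-⨁⁻ (tabulate y) (subst (u ∈ᶜ_) (Σ⊕-cycle Z) u∈ΣZ))
          with E , E∈R , u∈E ← ∈Σ⊕⁻ R u∈ΣR
          with refl ← outer-fresh i (R⊆F E∈R) u∈E
          = Unique-++⁻ unique′ (Mem.∈-tabulate⁺ {f = clause} i) E∈R
        yₘ = y (fromℕ len)
        forced : defect a ΣZ ≡ true → P (unit yₘ (not (a yₘ)))
        forced = propagate-cycle Z (Pφ ∘ F⊆φ ∘ clause∈φ) a
                   (λ i → units (y (inject₁ i)) (outer≢u₀ i) (outer∈Σ⊕ (inject₁ i)))
        cases : ∀ d → defect a ΣZ ≡ d → P ⊥-clause ⊎ P (unit u₀ (not (a u₀)))
        cases true Z-odd with yₘ Fin.≟ u₀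
        ... | yes yₘ≡u₀ = inj₂ (subst (λ u → P (unit u (not (a u)))) yₘ≡u₀ (forced Z-odd))
        ... | no  yₘ≢u₀ = inj₁ (clash yₘ (a yₘ) (units yₘ yₘ≢u₀ (outer∈Σ⊕ (fromℕ len))) (forced Z-odd))
        cases false Z-even = IH R< (Unique-resp-⊆ (Sublist.++⁺ˡ (tabulate clause) ⊆-refl) unique′) (F⊆φ ∘ R⊆F) u₀ a
          (λ u u≢u₀ u∈ΣR → units u u≢u₀ (subst (u ∈ᶜ_) (sym ΣF≡) (∈-⊕ʳ ΣZ (Σ⊕ R) (Bool.¬-not (∉ΣZ u u∈ΣR)) u∈ΣR)))
          (trans (sym (trans (defect-⊕ a ΣZ (Σ⊕ R)) (cong (_xor defect a (Σ⊕ R)) Z-even)))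
                 (trans (cong (defect a) (sym ΣF≡)) odd))

    -- Starting the cycle at a clause D with u₀ makes u₀, if it is an outer variable, the one of
    -- the closing clause, and this is the one that the path rule derives.
    propagate-from : ∀ u₀ D → D ∈ F → (∀ {E} → E ∈ F → u₀ ∈ᶜ E → u₀ ∈ᶜ D) → Propagates (Σ⊕ F) u₀
    propagate-from u₀ D D∈F u₀∈D
      with R , F↭ ← extract D∈F
      with Any.any? (λ E → Fin.any? λ u → u ∈ᶜ? D ×-dec u ∈ᶜ? E) R
    ... | no isolated = subst (λ C → Propagates C u₀) (sym (Σ⊕-↭ F↭))
      (propagate-disjoint D (Σ⊕ R)
        (λ u u∈D u∈ΣR → let E , E∈R , u∈E = ∈Σ⊕⁻ R u∈ΣR in isolated (lose E∈R (u , u∈D , u∈E)))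
        (propagate-ternary (Is3XorNF.threeVars nf (F⊆φ D∈F)) (Pφ (F⊆φ D∈F)))
        (IH (subst (length R <_) (sym (↭-length F↭)) ℕ.≤-refl)
            (Unique-resp-⊆ (D ∷ʳ ⊆-refl) (Unique-resp-↭ F↭ unique))
            (λ C∈R → F⊆φ (∈-resp-↭ (↭-sym F↭) (there C∈R))))
        u₀)
    ... | yes found
      with C , C∈R , v , v∈D , v∈C ← find found
      with Grow.split-or-cycle (Is3XorNF-⊆ F⊆φ nf) unique {D} {C} D∈F (∈-resp-↭ (↭-sym F↭) (there C∈R)) v∈D v∈C D≢C
      where
      D≢C : D ≢ C
      D≢C refl with D∉R ∷ _ ← Unique-resp-↭ F↭ unique = All.lookup D∉R C∈R refl
    ... | inj₁ split = propagate-split split u₀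
    ... | inj₂ (Z , last≡D , _)
      with Fin.any? (λ i → Any.any? (λ E → ¬? (E ≟ᶜ XorCycle.clause Z i) ×-dec XorCycle.y Z i ∈ᶜ? E) F)
    ...   | no fresh = propagate-around u₀ Z
      (λ i {E} E∈F y∈E → decidable-stable (E ≟ᶜ XorCycle.clause Z i) λ E≢ → fresh (i , lose E∈F (E≢ , y∈E)))
      (λ E∈F u₀∈E → subst (u₀ ∈ᶜ_) (sym last≡D) (u₀∈D E∈F u₀∈E))
    -- An outer variable shared with another clause `E` gives a split or is an inner variable of a
    -- second cycle, which the partition forbids.
    ...   | yes (i , shared)
      with E , E∈F , E≢ , y∈E ← find shared
      with Grow.split-or-cycle (Is3XorNF-⊆ F⊆φ nf) unique {E} {XorCycle.clause Z i}
             E∈F (XorCycle.clause∈φ Z i) y∈E (outer∈clause Z i) E≢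
    ...     | inj₁ split = propagate-split split u₀
    ...     | inj₂ (Z′ , _ , x≡y) =
      contradiction x≡y (inner-outer-disjoint (XorCycle-⊆ F⊆φ Z′) (XorCycle-⊆ F⊆φ Z) zero i)

  -- Strong induction on the number of clauses, bounded by `m`. The starting clause contains `u₀`
  -- whenever some clause does, and is arbitrary otherwise.
  propagate-sum : ∀ m {F} → length F ≤ m → Unique F → (∀ {C} → C ∈ F → C ∈ φ) → SumPropagates F
  propagate-sum m {[]} _ _ _ u₀ a _ odd = contradiction (trans (sym odd) (defect-𝟘 a)) λ ()
  propagate-sum (suc m) {F@(C ∷ _)} ∣F∣≤m unique F⊆φ u₀ with Any.any? (u₀ ∈ᶜ?_) F
  ... | yes found with D , D∈F , u₀∈D ← find found =
    propagate-from unique F⊆φ (λ G<F → propagate-sum m (ℕ.≤-pred (ℕ.≤-trans G<F ∣F∣≤m))) u₀ D D∈F (λ _ _ → u₀∈D)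
  ... | no absent =
    propagate-from unique F⊆φ (λ G<F → propagate-sum m (ℕ.≤-pred (ℕ.≤-trans G<F ∣F∣≤m))) u₀ C (here refl)
      (λ E∈F u₀∈E → contradiction (lose E∈F u₀∈E) absent)

-- From violated sums to deducibility

infix 4 _∈ˡ?_

_∈ˡ?_ : (l : Literal n) (ls : List (Literal n)) → Dec (l ∈ ls)
_∈ˡ?_ = DecMembership._∈?_ (×-≡-dec Fin._≟_ Bool._≟_)

⊩-unit : ∀ a (u : Fin n) {b} → a ⊩ unit u b → b ≡ a u
⊩-unit a u p = trans (sym p) (trans (value-⨁ a (u ∷ [])) (xor-identityʳ (a u)))

unit-⊩ : ∀ a (u : Fin n) {b} → b ≡ a u → a ⊩ unit u b
unit-⊩ a u b≡ = trans (value-⨁ a (u ∷ [])) (trans (xor-identityʳ (a u)) (sym b≡))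

module Refutation {φ : Formula n} (nf : Is3XorNF φ) (partition : CyclePartitionable φ)
                  {P : XorClause n → Set} (closed : Closed EC P) (Pφ : ∀ {C} → C ∈ φ → P C) where
  open Deduction nf partition closed Pφ
  open Propagation closed

  record Refuting (ls : List (Literal n)) (a : Assignment n) : Set where
    field
      sum       : XorClause n
      assigned  : ∀ u → u ∈ᶜ sum → (u , a u) ∈ ls
      violated  : defect a sum ≡ true
      variable₀ : Fin n
      propagate : ∀ u₀ → Propagates sum u₀

  -- A subset of the clauses sums to the contradiction: `F` from `φ`, `G` from the literals.
  -- Variables of `Σ⊕ F` must cancel against `Σ⊕ G`, so they are assigned; `a` satisfies `G`, so it
  -- violates `Σ⊕ F`. Duplicates in `φ` are removed first, as the induction needs distinct clauses.
  refuting : ∀ ls → Unsatisfiable (φ ++ map litClause ls) → ∀ a → All (λ (u , b) → b ≡ a u) ls → Refuting ls a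
  refuting ls unsat a a⊨ls with satisfiable-or-refuted (deduplicate _≟ᶜ_ φ ++ map litClause ls)
  ... | inj₁ (w , w⊩) = contradiction (w , All.++⁺ (All.tabulate (All.lookup w⊩φ ∘ Mem.∈-deduplicate⁺ _≟ᶜ_)) w⊩ls) unsat
    where
    w⊩φ = All.++⁻ˡ (deduplicate _≟ᶜ_ φ) w⊩
    w⊩ls = All.++⁻ʳ (deduplicate _≟ᶜ_ φ) w⊩
  ... | inj₂ (_ , H⊆ , Σ≡⊥)
    with F , G , refl , F⊆ , G⊆ ← ⊆-++⁻ (deduplicate _≟ᶜ_ φ) H⊆ = record
    { sum       = Σ⊕ F
    ; assigned  = assigned
    ; violated  = violated
    ; variable₀ = some-variable F F⊆φ violated
    ; propagate = propagate-sum (length F) ℕ.≤-refl (Unique-resp-⊆ F⊆ (deduplicate-! _≟ᶜ_ φ)) F⊆φ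
    }
    where
    Σ≡ : Σ⊕ F ⊕ Σ⊕ G ≡ ⊥-clause
    Σ≡ = trans (sym (Σ⊕-++ F G)) Σ≡⊥
    F⊆φ : ∀ {C} → C ∈ F → C ∈ φ
    F⊆φ C∈F = Mem.∈-deduplicate⁻ _≟ᶜ_ φ (⊆-lookup F⊆ C∈F)
    a⊩ls : a ⊩* map litClause ls
    a⊩ls = All.map⁺ (All.map (λ {(u , b)} b≡ → unit-⊩ a u b≡) a⊨ls)
    violated : defect a (Σ⊕ F) ≡ true
    violated = begin
      defect a (Σ⊕ F)                          ≡⟨ xor-identityʳ _ ⟨
      defect a (Σ⊕ F) xor false                ≡⟨ cong (defect a (Σ⊕ F) xor_) (defect-Σ⊕ a⊩ls G⊆) ⟨
      defect a (Σ⊕ F) xor defect a (Σ⊕ G)      ≡⟨ defect-⊕ a (Σ⊕ F) (Σ⊕ G) ⟨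
      defect a (Σ⊕ F ⊕ Σ⊕ G)                   ≡⟨ cong (defect a) Σ≡ ⟩
      defect a ⊥-clause                        ≡⟨ cong (_xor true) (value-⊥ a) ⟩
      true                                     ∎
      where open ≡-Reasoning
    -- The empty sum is never violated, so `F` has a first clause, which has variables.
    some-variable : ∀ F → (∀ {C} → C ∈ F → C ∈ φ) → defect a (Σ⊕ F) ≡ true → Fin n
    some-variable []      _   odd = contradiction (trans (sym odd) (defect-𝟘 a)) λ ()
    some-variable (C ∷ _) F⊆φ _   =
      proj₁ (∣S∣>0⇒inhabited (vars C) (subst (0 <_) (sym (Is3XorNF.threeVars nf (F⊆φ (here refl)))) (s≤s z≤n)))
    ∈F⇒∈G : ∀ u → u ∈ᶜ Σ⊕ F → u ∈ᶜ Σ⊕ G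
    ∈F⇒∈G u u∈F = sym (xor≡false⇒≡ true _ (trans (cong (_xor lookup (vars (Σ⊕ G)) u) (sym u∈F))
      (trans (sym (lookup-△ (vars (Σ⊕ F)) (vars (Σ⊕ G)) u))
             (trans (cong (λ C → lookup (vars C) u) Σ≡) (lookup-⊥ u)))))
    assigned : ∀ u → u ∈ᶜ Σ⊕ F → (u , a u) ∈ ls
    assigned u u∈F
      with E , E∈G , u∈E ← ∈Σ⊕⁻ G (∈F⇒∈G u u∈F)
      with (x , b) , l∈ls , refl ← Mem.∈-map⁻ litClause (⊆-lookup G⊆ E∈G)
      with here refl ← lookup-⨁⁻ (x ∷ []) u∈E
      = subst (λ c → (x , c) ∈ ls) (All.lookup a⊨ls l∈ls) l∈ls

  -- The assignment makes true exactly the variables with a positive literal in `ls`. It can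
  -- disagree only with a negative literal whose positive counterpart is in `ls` too, and these two
  -- clash.
  refute : ∀ ls → All (P ∘ litClause) ls → Unsatisfiable (φ ++ map litClause ls) → P ⊥-clause
  refute ls Pls unsat with All.all? (λ (u , b) → b Bool.≟ does ((u , true) ∈ˡ? ls)) ls
  ... | yes a⊨ls = propagates⇒refutes sum variable₀ (propagate variable₀) _
                     (λ u u∈C → All.lookup Pls (assigned u u∈C)) violated
    where open Refuting (refuting ls unsat (λ u → does ((u , true) ∈ˡ? ls)) a⊨ls)
  ... | no ¬a⊨ls with find (All.¬All⇒Any¬ (λ (u , b) → b Bool.≟ does ((u , true) ∈ˡ? ls)) ls ¬a⊨ls)
  ...   | (u , true)  , l∈ls , b≢ = contradiction (sym (dec-true ((u , true) ∈ˡ? ls) l∈ls)) b≢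
  ...   | (u , false) , l∈ls , b≢ with (u , true) ∈ˡ? ls
  ...     | yes l′∈ls = clash u true (All.lookup Pls l′∈ls) (All.lookup Pls l∈ls)
  ...     | no  _     = contradiction refl b≢

  -- Adding the negated literal makes the formula unsatisfiable. The model `v` flipped at `x` still
  -- satisfies `ls`, since the only literal on `x` true under `v` is the excluded `(x , b)`. In the
  -- refuting sum every variable except `x` has a unit, so propagation with `x` as `u₀` forces the
  -- value `b`.
  imply : ∀ ls → All (P ∘ litClause) ls → ∀ x b → ∀ v → v ⊩* (φ ++ map litClause ls) → ¬ P ⊥-clause →
          (φ ++ map litClause ls) ⊨ unit x b → P (unit x b)
  imply ls Pls x b v v⊩ consistent entails with (x , b) ∈ˡ? ls
  ... | yes l∈ls = All.lookup Pls l∈ls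
  ... | no  l∉ls = [ (λ p⊥ → contradiction p⊥ consistent)
                   , subst (P ∘ unit x) (trans (cong not ax≡) (Bool.not-involutive b)) ]′
                   (propagate x a units violated)
    where
    ls′ = (x , not b) ∷ ls
    vx≡ : b ≡ v x
    vx≡ = ⊩-unit v x (entails v v⊩)
    a : Assignment n
    a = flip x v
    ax≡ : a x ≡ not b
    ax≡ = trans (flip-≡ x v) (cong not (sym vx≡))
    a⊨ls : ∀ {l} → l ∈ ls → proj₂ l ≡ a (proj₁ l)
    a⊨ls {u , c} l∈ls = trans c≡vu (sym (flip-≢ {u = u} {x} v
      λ { refl → l∉ls (subst (λ d → (x , d) ∈ ls) (trans c≡vu (sym vx≡)) l∈ls) }))
      where
      c≡vu : c ≡ v u
      c≡vu = ⊩-unit v u (All.lookup v⊩ (Mem.∈-++⁺ʳ φ (Mem.∈-map⁺ litClause l∈ls)))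
    unsat : Unsatisfiable (φ ++ map litClause ls′)
    unsat (w , w⊩) with w⊩φ , wx ∷ w⊩ls ← All.++⁻ φ w⊩ =
      Bool.not-¬ {b} refl (trans (⊩-unit w x (entails w (All.++⁺ w⊩φ w⊩ls))) (sym (⊩-unit w x wx)))
    open Refuting (refuting ls′ unsat a (sym ax≡ ∷ All.tabulate a⊨ls))
    units : ∀ u → u ≢ x → u ∈ᶜ sum → P (unit u (a u))
    units u u≢x u∈C with assigned u u∈C
    ... | here eq    = contradiction (cong proj₁ eq) u≢x
    ... | there l∈ls = All.lookup Pls l∈ls

-- Derivability by `R` is `R`-closed, hence EC-closed by `simulates`, and serves as `P`. Soundness
-- excludes a derived contradiction when the formula has a model.
deducible : ∀ {R : Rules n} → (∀ {P} → Closed R P → Closed EC P) → (∀ v → Closed R (v ⊩_)) →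
            ∀ {φ} → Is3XorNF φ → CyclePartitionable φ → Deducible R φ
deducible {n} {R} simulates sound {φ} nf partition = record
  { refutes = λ ls _ unsat → Deduce.refute ls ls (Deduce.literals ls) unsat
  ; implies = λ { ls _ (x , b) _ (v , v⊩) entails → 
      Deduce.imply ls ls (Deduce.literals ls) x b v v⊩ (Deduce.consistent ls v v⊩) entails }
  }
  where
  module Deduce (ls : List (Literal n)) where
    ψ = φ ++ map litClause ls
    open Refutation nf partition (simulates (⊢-closed {R = R} {ψ})) (⊢-premise ∘ Mem.∈-++⁺ˡ) public
    literals : All (λ l → ψ ⊢[ R ] litClause l) ls
    literals = All.tabulate λ l∈ls → ⊢-premise (Mem.∈-++⁺ʳ φ (Mem.∈-map⁺ litClause l∈ls))
    consistent : ∀ v → v ⊩* ψ → ¬ ψ ⊢[ R ] ⊥-clause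
    consistent v v⊩ ⊢⊥ = contradiction (trans (sym (value-⊥ v)) (⊢-minimal (sound v) v⊩ ⊢⊥)) λ ()

Subst-sound : ∀ (v : Assignment n) → Closed Subst (v ⊩_)
Subst-sound v = ⊕-closed⇒Subst-closed λ {C} {D} → ⊩-⊕ {v = v} {C} {D}

theorem2 : ∀ {n : ℕ} (φ : Formula n) → Is3XorNF φ → CyclePartitionable φ → Deducible Subst φ × Deducible EC φ
theorem2 φ nf partition =
    deducible Subst-closed⇒EC-closed Subst-sound nf partition
  , deducible (λ closed → closed) (Subst-closed⇒EC-closed ∘ Subst-sound) nf partition
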